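{- Let $F=\prod_{s\in S}\mathbb{F}_{q_s}/\mathcal{D}$ be an ultra-finite field, with internal cardinality $\kappa=\mathrm{ulim}_{s\in S}q_s\in\mathbb{N}^{\#}$. Let $n\in\mathbb{N}^{\#}$ be a hypernatural number such that $n$ divides $\kappa-1$ in $\mathbb{Z}^{\#}$. Let $P$ and $Q$ be monic irreducible polynomials in $F[t]$ of degrees $d$ and $\ell$, respectively. Then $$\left(\frac{Q}{P}\right)_n=(-1)^{\frac{\kappa-1}{n}d\ell}\left(\frac{P}{Q}\right)_n .$$
   Context: Fix an infinite set $S$ and a nonprincipal ultrafilter $\mathcal{D}$ on $S$; "for $\mathcal{D}$-almost all $s$" means for all $s$ in some set belonging to $\mathcal{D}$. $\prod_{s\in S}A_s/\mathcal{D}$ denotes the ultraproduct of sets $A_s$, and $\mathrm{ulim}_{s\in S}a_s$ the class of $(a_s)_{s\in S}$. Hyperintegers: $\mathbb{Z}^{\#}=\prod_{s\in S}\mathbb{Z}/\mathcal{D}$; hypernaturals: $\mathbb{N}^{\#}=\prod_{s\in S}\mathbb{N}/\mathcal{D}$ with $\mathbb{N}=\{1,2,\ldots\}$; $\mathbb{Z}\subset\mathbb{Z}^{\#}$ diagonally. $a$ divides $b$ in $\mathbb{Z}^{\#}$ if $b=ac$ for some $c\in\mathbb{Z}^{\#}$. An ultra-finite field is $F=\prod_{s\in S}\mathbb{F}_{q_s}/\mathcal{D}$, where $\mathbb{F}_{q_s}$ is the finite field with $q_s$ elements ($q_s$ a prime power) for $\mathcal{D}$-almost all $s$. Its internal cardinality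 is $\kappa=\mathrm{ulim}_s q_s$. Let $\mathcal{U}(F[t])=\prod_{s\in S}\mathbb{F}_{q_s}[t]/\mathcal{D}$ (the ultra-hull of $F[t]$). $F[t]$ is a subring of $\mathcal{U}(F[t])$ by sending $\sum_{i\le m}a_it^i$, $a_i=\mathrm{ulim}_s a_{i,s}$, to $\mathrm{ulim}_s\sum_{i\le m}a_{i,s}t^i$. For an element $a=\mathrm{ulim}_s a_s$ of an ultraproduct of rings and a nonnegative hyperinteger $e=\mathrm{ulim}_s e_s$, put $a^e:=\mathrm{ulim}_s a_s^{e_s}$. Power residue symbol: let $n\in\mathbb{N}^{\#}$ divide $\kappa-1$ and let $P\in F[t]$ be irreducible of degree $d\in\mathbb{Z}_{>0}$. For $\alpha\in F[t]$ not divisible by $P$, $\left(\frac{\alpha}{P}\right)_n$ is the unique element of $F^{\times}$ with $\alpha^{\frac{\kappa^d-1}{n}}\equiv\left(\frac{\alpha}{P}\right)_n \pmod{P\,\mathcal{U}(F[t])}$; if $P$ divides $\alpha$, $\left(\frac{\alpha}{P}\right)_n:=0$. -}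

module Defs where

open import Algebra.Bundles using (CommutativeRing)
open import Algebra.Bundles.Raw using (RawRing)
import Algebra.Definitions.RawSemiring as RawSemiringDefs
open import Data.Fin.Base using (Fin)
open import Data.Integer.Base as ℤ using (ℤ; +_; -[1+_]; ∣_∣; _/ℕ_)
open import Data.List.Base using (List; []; _∷_; map)
open import Data.Nat.Base as ℕ using (ℕ; zero; suc; NonZero; _<_)
open import Data.Nat.DivMod using (m*n/n≡m; m*n%n≡0)
open import Data.Nat.Primality using (Prime)
open import Data.Product.Base using (∃-syntax; ∃₂; _×_; _,_)
open import Data.Sum.Base using (_⊎_)
open import Function.Bundles using (Bijection; _↔_)
open import Level using (0ℓ)
open import Relation.Binary.PropositionalEquality
  using (_≡_; refl; cong; setoid)
open import Relation.Nullary.Negation.Core using (¬_)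
open import Relation.Unary using (Pred; _∈_; _∉_; _⊆_; _∩_; ∁; ｛_｝; Satisfiable)

------------------------------------------------------------------------
-- Ultrafilters

Infinite : Set → Set
Infinite S = ∀ k → ¬ (Fin k ↔ S)

-- Properness (∅ ∉ 𝒟) is required in its positive form: every member has an
-- element.  Applied to constant predicates, `inhabited` and `ultra` decide
-- every type in Set; the classical logic used with ultrafilters thus comes
-- with the ultrafilter.

record IsNonprincipalUltrafilter {S : Set} (𝒟 : Pred (Pred S 0ℓ) 0ℓ) : Set₁ where
  field
    upward       : ∀ {A B} → A ⊆ B → A ∈ 𝒟 → B ∈ 𝒟
    intersection : ∀ {A B} → A ∈ 𝒟 → B ∈ 𝒟 → A ∩ B ∈ 𝒟
    inhabited    : ∀ {A} → A ∈ 𝒟 → Satisfiable A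
    ultra        : ∀ A → A ∈ 𝒟 ⊎ ∁ A ∈ 𝒟
    nonprincipal : ∀ x → ｛ x ｝ ∉ 𝒟

------------------------------------------------------------------------
-- Ultraproducts

-- A class ulim aₛ is given by a representing family, with equality
-- "for 𝒟-almost all s".

ultraproduct : {S : Set} → Pred (Pred S 0ℓ) 0ℓ → (S → RawRing 0ℓ 0ℓ) → RawRing 0ℓ 0ℓ
ultraproduct 𝒟 R = record
  { Carrier = ∀ s → Carrier (R s)
  ; _≈_     = λ a b → (λ s → _≈_ (R s) (a s) (b s)) ∈ 𝒟
  ; _+_     = λ a b s → _+_ (R s) (a s) (b s)
  ; _*_     = λ a b s → _*_ (R s) (a s) (b s)
  ; -_      = λ a s → -_ (R s) (a s)
  ; 0#      = λ s → 0# (R s)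
  ; 1#      = λ s → 1# (R s)
  }
  where open RawRing

------------------------------------------------------------------------
-- Polynomials

-- Coefficients are listed from the constant term upwards; lists may end in
-- zeros, so equality is equality of all coefficients.

module Polynomials (R : RawRing 0ℓ 0ℓ) where
  open RawRing R

  coeff : List Carrier → ℕ → Carrier
  coeff []      _       = 0#
  coeff (a ∷ p) zero    = a
  coeff (a ∷ p) (suc i) = coeff p i

  add : List Carrier → List Carrier → List Carrier
  add []      q       = q
  add (a ∷ p) []      = a ∷ p
  add (a ∷ p) (b ∷ q) = (a + b) ∷ add p q

  mul : List Carrier → List Carrier → List Carrier
  mul []      q = []
  mul (a ∷ p) q = add (map (a *_) q) (0# ∷ mul p q)

  polynomialRing : RawRing 0ℓ 0ℓ
  polynomialRing = record
    { Carrier = List Carrier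
    ; _≈_     = λ p q → ∀ i → coeff p i ≈ coeff q i
    ; _+_     = add
    ; _*_     = mul
    ; -_      = map -_
    ; 0#      = []
    ; 1#      = 1# ∷ []
    }

  HasDegree : List Carrier → ℕ → Set
  HasDegree p d = coeff p d ≉ 0# × (∀ i → d < i → coeff p i ≈ 0#)

  Monic : List Carrier → Set
  Monic p = ∃[ d ] HasDegree p d × coeff p d ≈ 1#

open Polynomials using (polynomialRing)

------------------------------------------------------------------------
-- Hyperintegers

record ℕ⁺ : Set where
  constructor pos
  field
    value       : ℕ
    {{nonZero}} : NonZero value

open ℕ⁺ using (value; nonZero)

module Hyperintegers {S : Set} (𝒟 : Pred (Pred S 0ℓ) 0ℓ) where

  ℤ# : RawRing 0ℓ 0ℓ
  ℤ# = ultraproduct 𝒟 (λ _ → ℤ.+-*-rawRing)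

  open RawRing ℤ# public renaming (Carrier to Hyperinteger; -_ to neg)
  open RawSemiringDefs rawSemiring public using (_∣_; _^_)

  infixl 6 _-_
  _-_ : Hyperinteger → Hyperinteger → Hyperinteger
  a - b = a + neg b

  Hypernatural : Set
  Hypernatural = S → ℕ⁺

  fromHypernatural : Hypernatural → Hyperinteger
  fromHypernatural n s = + value (n s)

  diagonal : ℕ → Hyperinteger
  diagonal k _ = + k

  -- Floor division on representatives; by ÷-exact it is the quotient in ℤ#
  -- whenever n divides b.

  infixl 7 _÷_
  _÷_ : Hyperinteger → Hypernatural → Hyperinteger
  (b ÷ n) s = _/ℕ_ (b s) (value (n s)) {{nonZero (n s)}}

  private
    [c*m]/m≡c : ∀ c m .{{_ : NonZero m}} → (c ℤ.* + m) /ℕ m ≡ c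
    [c*m]/m≡c (+ zero)  m@(suc _) = refl
    [c*m]/m≡c (+ suc k) m@(suc _) = cong +_ (m*n/n≡m (suc k) m)
    [c*m]/m≡c -[1+ k ]  m@(suc _)
      rewrite m*n%n≡0 (suc k) m {{_}} | m*n/n≡m (suc k) m {{_}} = refl

    pointwise : ∀ c b m .{{_ : NonZero m}} →
                c ℤ.* + m ≡ b → (b /ℕ m) ℤ.* + m ≡ b
    pointwise c _ m refl = cong (ℤ._* + m) ([c*m]/m≡c c m)

  ÷-exact : IsNonprincipalUltrafilter 𝒟 → ∀ n b →
            fromHypernatural n ∣ b → (b ÷ n) * fromHypernatural n ≈ b
  ÷-exact U n b record { quotient = c ; equality = c*n≈b } = upward
    (λ {s} → pointwise (c s) (b s) (value (n s)) {{nonZero (n s)}})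
    c*n≈b
    where open IsNonprincipalUltrafilter U

  -- This is ulim (aₛ ^ eₛ); meant for e ≥ 0 only, where ∣ eₛ ∣ = eₛ for 𝒟-almost all s.

  module _ (R : S → RawRing 0ℓ 0ℓ) where
    open RawRing (ultraproduct 𝒟 R) using () renaming (Carrier to A)

    hyperpower : A → Hyperinteger → A
    hyperpower a e s = power (a s) ∣ e s ∣
      where open RawSemiringDefs (RawRing.rawSemiring (R s)) renaming (_^_ to power)

------------------------------------------------------------------------
-- Ultra-finite fields

IsPrimePower : ℕ → Set
IsPrimePower q = ∃₂ λ p k → Prime p × q ≡ p ℕ.^ suc k

record IsFiniteField (R : CommutativeRing 0ℓ 0ℓ) (q : ℕ) : Set where
  open CommutativeRing R using (Carrier; _≈_; _≉_; _*_; 0#; 1#)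
                         renaming (setoid to ringSetoid)
  field
    1≉0        : 1# ≉ 0#
    inverse    : ∀ x → x ≉ 0# → ∃[ y ] x * y ≈ 1#
    primePower : IsPrimePower q
    bijection  : Bijection (setoid (Fin q)) ringSetoid

-- Components outside a set of 𝒟 are arbitrary commutative rings.

record UltraFiniteField {S : Set} (𝒟 : Pred (Pred S 0ℓ) 0ℓ) : Set₁ where
  field
    q            : S → ℕ⁺
    𝔽            : S → CommutativeRing 0ℓ 0ℓ
    almostFinite : (λ s → IsFiniteField (𝔽 s) (value (q s))) ∈ 𝒟

module PowerResidue {S : Set} (𝒟 : Pred (Pred S 0ℓ) 0ℓ) (field# : UltraFiniteField 𝒟) where
  open UltraFiniteField field#
  open Hyperintegers 𝒟 public
    using (Hyperinteger; Hypernatural; fromHypernatural; diagonal; _÷_; hyperpower)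
  module ℤ# = Hyperintegers 𝒟

  componentRing : S → RawRing 0ℓ 0ℓ
  componentRing s = CommutativeRing.rawRing (𝔽 s)

  κ : Hyperinteger
  κ = fromHypernatural q

  F F[t] 𝒰 : RawRing 0ℓ 0ℓ
  F    = ultraproduct 𝒟 componentRing
  F[t] = polynomialRing F
  𝒰    = ultraproduct 𝒟 (λ s → polynomialRing (componentRing s))

  module F where
    open RawRing F public
    open RawSemiringDefs rawSemiring public using (_∣_)

  module F[t] where
    open RawRing F[t] public
    open Polynomials F public using (coeff; HasDegree; Monic)
    open RawSemiringDefs rawSemiring public using (_∣_; _∤_; Irreducible)

  module 𝒰 where
    open RawRing 𝒰 public
    open RawSemiringDefs rawSemiring public using (_∣_)

  infixr 8 _^F_ _^𝒰_
  _^F_ : F.Carrier → Hyperinteger → F.Carrier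
  _^F_ = hyperpower componentRing

  _^𝒰_ : 𝒰.Carrier → Hyperinteger → 𝒰.Carrier
  _^𝒰_ = hyperpower (λ s → polynomialRing (componentRing s))

  embed : F[t].Carrier → 𝒰.Carrier
  embed α s = map (λ a → a s) α

  constant : F.Carrier → 𝒰.Carrier
  constant x = embed (x ∷ [])

  _≅_mod_ : 𝒰.Carrier → 𝒰.Carrier → F[t].Carrier → Set
  a ≅ b mod P = embed P 𝒰.∣ (a 𝒰.+ (𝒰.- b))

  -- n ∣ κ - 1 gives n ∣ κ ^ d - 1, so the division by n is exact.

  IsResidue : Hypernatural → (P : F[t].Carrier) (d : ℕ) (α : F[t].Carrier) → F.Carrier → Set
  IsResidue n P d α x =
    x F.∣ F.1# ×
    (embed α ^𝒰 ((κ ℤ#.^ d ℤ#.- ℤ#.1#) ÷ n)) ≅ constant x mod P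

  -- The graph of the symbol: "x is the value of (α / P)ₙ".  The definite
  -- description is spelled out, so a value carries its uniqueness with it.

  IsPowerResidueSymbol : Hypernatural → (P α : F[t].Carrier) → F.Carrier → Set
  IsPowerResidueSymbol n P α x =
    (P F[t].∣ α → x F.≈ F.0#) ×
    (P F[t].∤ α → ∃[ d ] F[t].HasDegree P d × IsResidue n P d α x ×
                         (∀ y → IsResidue n P d α y → y F.≈ x))

{-# OPTIONS --safe #-}
module Submission where

-- Reciprocity is proved over a single finite field and then carried over to the
-- ultraproduct.
--
-- Let k be a field with q elements, and K = k[t]/P, L = k[u]/Q for monic
-- irreducible P, Q of degrees d, ℓ that do not divide each other.  As
-- (q ^ d - 1) / n = (1 + q + ... + q ^ (d - 1)) * ((q - 1) / n), the symbol of Q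
-- modulo P is the power with exponent (q - 1) / n of the norm
-- Q(t) ^ (1 + q + ... + q ^ (d - 1)), which is the product of the Q(t ^ (q ^ i))
-- because the q-th power map is a ring homomorphism of K that fixes k.  The
-- conjugates t ^ (q ^ i), i < d, are distinct roots of P, so P splits into the
-- factors X - t ^ (q ^ i) (splitting), and Q likewise over L.  In the ring
-- L[t]/P, which contains both K and L, the norm of Q(t) is therefore the product
-- of all differences t ^ (q ^ i) - u ^ (q ^ j) (norm-image).  The norm of P(u) is
-- the product of the opposite differences, whence the sign (-1) ^ (d * ℓ)
-- (norm-reciprocity).  No common splitting field is needed.
--
-- Behind this are three facts about finite fields.  In a field with N elements,
-- x ^ N = x, by comparing products over the units (fermat).  The other two are
-- proved by counting roots: (X + 1) ^ q - X ^ q - 1 has q coefficients and q roots,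
-- hence is zero, which makes the q-th power map additive ([x+y]^q); and an element
-- of K fixed by that map would be a root too many of X ^ q - X unless it lies in k
-- (fixed-by-frobenius), so that norms lie in k.
--
-- For the transfer, the ultrafilter decides every type in Set, which gives
-- excluded middle and the choice of families of witnesses.  The degrees d and ℓ
-- being standard, the factors and remainders involved have boundedly many
-- coefficients, and so form polynomials over F; hence irreducibility
-- (component-splits) and non-divisibility (component-∤) pass to almost all
-- components.  If P divides Q in F[t], then Q divides P and both symbols are 0.

open import Algebra.Bundles using (CommutativeRing)
open import Algebra.Bundles.Raw using (RawRing)
import Algebra.Definitions.RawSemiring as RawSemiringDefs
import Algebra.Properties.CommutativeMonoid.Sum as Sum
import Algebra.Properties.CommutativeSemiring.Exp as Exp
import Algebra.Properties.Ring as RingProperties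
import Algebra.Solver.Ring.NaturalCoefficients.Default as SemiringSolver
open import Algebra.Structures using (IsCommutativeRing)
open import Data.Fin.Base using (Fin; zero; suc; punchIn; toℕ; funToFin; finToFun; combine; inject≤)
open import Data.Fin.Permutation using (Permutation; permutation)
open import Data.Fin.Properties using (suc-injective; punchInᵢ≢i; funToFin-finToFin; finToFun-funToFin;
  toℕ<n; toℕ-injective; inject≤-injective)
open import Data.Integer.Base as ℤ using (ℤ; +_; ∣_∣; _/ℕ_)
import Data.Integer.Properties as ℤ
open import Data.List.Base using (List; []; _∷_; map; length; tabulate; drop)
open import Data.List.Properties using (map-id; length-map; length-tabulate; map-tabulate)
open import Data.Nat.Base as ℕ using (ℕ; zero; suc; _≤_; _<_; z≤n; s≤s; _∸_)
open import Data.Nat.DivMod using (m*n/n≡m)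
import Data.Nat.Properties as ℕ
open import Data.Nat.Solver using (module +-*-Solver)
open import Data.Product.Base using (_,_; ∃-syntax; _×_; ∃₂; proj₁; proj₂; Σ-syntax)
open import Data.Sum.Base as ⊎ using (_⊎_; inj₁; inj₂)
open import Data.Vec.Functional using (removeAt; replicate)
open import Function.Base using (_∘_; case_of_)
open import Function.Bundles using (Bijection)
open import Level using (0ℓ)
open import Relation.Binary.Definitions using (tri<; tri≈; tri>)
open import Relation.Binary.PropositionalEquality as ≡ using (_≡_)
import Relation.Binary.Reasoning.Setoid as SetoidReasoning
open import Relation.Binary.Structures using (IsEquivalence)
open import Relation.Nullary.Decidable.Core using (Dec; yes; no)
open import Relation.Nullary.Negation.Core using (¬_; contradiction)
open import Relation.Unary using (Pred; _∈_; ∁)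
open import Defs

-- Conventions and exponents

Ring : Set₁
Ring = CommutativeRing 0ℓ 0ℓ

-- Classical logic for types in Set, as a hypothesis; the ultrafilter provides it.

ExcludedMiddle : Set₁
ExcludedMiddle = (A : Set) → Dec A

-- The geometric sum 1 + q + ... + q ^ (d - 1).

geometric : ℕ → ℕ → ℕ
geometric q zero    = 0
geometric q (suc d) = suc (q ℕ.* geometric q d)

geometric-sum : ∀ r d → suc (geometric (suc r) d ℕ.* r) ≡ suc r ℕ.^ d
geometric-sum r zero    = ≡.refl
geometric-sum r (suc d) = ≡.trans
  (solve 2 (λ r g → con 1 :+ (con 1 :+ (con 1 :+ r) :* g) :* r :=
                    (con 1 :+ r) :* (con 1 :+ g :* r))
    ≡.refl r (geometric (suc r) d))
  (≡.cong (suc r ℕ.*_) (geometric-sum r d))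
  where open +-*-Solver using (solve; _:=_; _:+_; _:*_; con)

-- The exponents (q ^ d - 1) / n of the residue and (q - 1) / n * d * ℓ of the sign
-- at one component, as absolute values of floor divisions of integers.

residueExponent : ℕ → ℕ⁺ → ℕ → ℕ
residueExponent q n d = ∣ _/ℕ_ (+ (q ℕ.^ d) ℤ.- + 1) (ℕ⁺.value n) {{ℕ⁺.nonZero n}} ∣

signExponent : ℕ → ℕ⁺ → ℕ → ℕ → ℕ
signExponent q n d ℓ = ∣ _/ℕ_ (+ q ℤ.- + 1) (ℕ⁺.value n) {{ℕ⁺.nonZero n}} ℤ.* + d ℤ.* + ℓ ∣

-- The exponents without division, for a field with q = r + 2 elements whose number
-- r + 1 of units is e * n.

module Exponents (r : ℕ) (n : ℕ⁺) (e : ℕ) (1+r≡en : suc r ≡ e ℕ.* ℕ⁺.value n) where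
  open ≡.≡-Reasoning
  private
    q : ℕ
    q = suc (suc r)

    _/n : ℕ → ℕ
    m /n = ℕ._/_ m (ℕ⁺.value n) {{ℕ⁺.nonZero n}}

    cancel : ∀ m → (m ℕ.* ℕ⁺.value n) /n ≡ m
    cancel m = m*n/n≡m m (ℕ⁺.value n) {{ℕ⁺.nonZero n}}

  residueExponent-geometric : ∀ d → residueExponent q n d ≡ geometric q d ℕ.* e
  residueExponent-geometric d = begin
    residueExponent q n d
      ≡⟨ ≡.cong (λ m → ∣ _/ℕ_ (+ m ℤ.- + 1) (ℕ⁺.value n) {{ℕ⁺.nonZero n}} ∣) (≡.sym (geometric-sum (suc r) d)) ⟩
    (geometric q d ℕ.* suc r) /n            ≡⟨ ≡.cong (λ m → (geometric q d ℕ.* m) /n) 1+r≡en ⟩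
    (geometric q d ℕ.* (e ℕ.* ℕ⁺.value n)) /n
      ≡⟨ ≡.cong _/n (≡.sym (ℕ.*-assoc (geometric q d) e (ℕ⁺.value n))) ⟩
    (geometric q d ℕ.* e ℕ.* ℕ⁺.value n) /n    ≡⟨ cancel (geometric q d ℕ.* e) ⟩
    geometric q d ℕ.* e                     ∎

  signExponent-product : ∀ d ℓ → signExponent q n d ℓ ≡ ℓ ℕ.* d ℕ.* e
  signExponent-product d ℓ = begin
    ∣ + (suc r /n) ℤ.* + d ℤ.* + ℓ ∣    ≡⟨ ℤ.abs-* (+ (suc r /n) ℤ.* + d) (+ ℓ) ⟩
    ∣ + (suc r /n) ℤ.* + d ∣ ℕ.* ℓ      ≡⟨ ≡.cong (ℕ._* ℓ) (ℤ.abs-* (+ (suc r /n)) (+ d)) ⟩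
    suc r /n ℕ.* d ℕ.* ℓ                ≡⟨ ≡.cong (λ m → m /n ℕ.* d ℕ.* ℓ) 1+r≡en ⟩
    (e ℕ.* ℕ⁺.value n) /n ℕ.* d ℕ.* ℓ      ≡⟨ ≡.cong (λ m → m ℕ.* d ℕ.* ℓ) (cancel e) ⟩
    e ℕ.* d ℕ.* ℓ                       ≡⟨ ≡.cong (ℕ._* ℓ) (ℕ.*-comm e d) ⟩
    d ℕ.* e ℕ.* ℓ                       ≡⟨ ℕ.*-comm (d ℕ.* e) ℓ ⟩
    ℓ ℕ.* (d ℕ.* e)                     ≡⟨ ≡.sym (ℕ.*-assoc ℓ d e) ⟩
    ℓ ℕ.* d ℕ.* e                       ∎

-- The ring of polynomials

module PolynomialRing (R : Ring) where
  open CommutativeRing R hiding (_-_)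
  open RingProperties ring using (-0#≈0#)
  open SetoidReasoning setoid
  open SemiringSolver commutativeSemiring using (solve; _:=_; _:+_; _:*_; con)
  open Polynomials rawRing public using (coeff; add; mul)

  -- Equality of all coefficients, as a record so that the two polynomials can be
  -- inferred from a proof of their equality.

  infix 4 _≋_
  record _≋_ (p q : List Carrier) : Set where
    constructor coeffwise
    field at : ∀ i → coeff p i ≈ coeff q i
  open _≋_ public

  scale : Carrier → List Carrier → List Carrier
  scale a = map (a *_)

  ≋-isEquivalence : IsEquivalence _≋_
  ≋-isEquivalence = record
    { refl  = coeffwise λ _ → refl
    ; sym   = λ p → coeffwise λ i → sym (at p i)
    ; trans = λ p q → coeffwise λ i → trans (at p i) (at q i)
    }

  coeff-add : ∀ p q i → coeff (add p q) i ≈ coeff p i + coeff q i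
  coeff-add []      q       i       = sym (+-identityˡ _)
  coeff-add (a ∷ p) []      i       = sym (+-identityʳ _)
  coeff-add (a ∷ p) (b ∷ q) zero    = refl
  coeff-add (a ∷ p) (b ∷ q) (suc i) = coeff-add p q i

  coeff-scale : ∀ a p i → coeff (scale a p) i ≈ a * coeff p i
  coeff-scale a []      i       = sym (zeroʳ a)
  coeff-scale a (b ∷ p) zero    = refl
  coeff-scale a (b ∷ p) (suc i) = coeff-scale a p i

  coeff-negate : ∀ p i → coeff (map -_ p) i ≈ - coeff p i
  coeff-negate []      i       = sym -0#≈0#
  coeff-negate (b ∷ p) zero    = refl
  coeff-negate (b ∷ p) (suc i) = coeff-negate p i

  ∷-cong : ∀ {a b p q} → a ≈ b → p ≋ q → a ∷ p ≋ b ∷ q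
  ∷-cong a≈b p≋q = coeffwise λ { zero → a≈b ; (suc i) → at p≋q i }

  add-cong : ∀ {p p′ q q′} → p ≋ p′ → q ≋ q′ → add p q ≋ add p′ q′
  add-cong {p} {p′} {q} {q′} e f = coeffwise λ i → begin
    coeff (add p q) i          ≈⟨ coeff-add p q i ⟩
    coeff p i + coeff q i      ≈⟨ +-cong (at e i) (at f i) ⟩
    coeff p′ i + coeff q′ i    ≈⟨ coeff-add p′ q′ i ⟨
    coeff (add p′ q′) i        ∎

  scale-cong : ∀ {a b p q} → a ≈ b → p ≋ q → scale a p ≋ scale b q
  scale-cong {a} {b} {p} {q} e f = coeffwise λ i →
    trans (coeff-scale a p i) (trans (*-cong e (at f i)) (sym (coeff-scale b q i)))

  coeff-∷*-zero : ∀ a p q → coeff (mul (a ∷ p) q) 0 ≈ a * coeff q 0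
  coeff-∷*-zero a p q = trans (coeff-add (scale a q) (0# ∷ mul p q) 0)
    (trans (+-identityʳ _) (coeff-scale a q 0))

  coeff-∷*-suc : ∀ a p q i →
    coeff (mul (a ∷ p) q) (suc i) ≈ a * coeff q (suc i) + coeff (mul p q) i
  coeff-∷*-suc a p q i = trans (coeff-add (scale a q) (0# ∷ mul p q) (suc i))
    (+-congʳ (coeff-scale a q (suc i)))

  mul-zeroʳ : ∀ p → mul p [] ≋ []
  mul-zeroʳ p = coeffwise (go p)
    where
    go : ∀ p i → coeff (mul p []) i ≈ 0#
    go []      i       = refl
    go (a ∷ p) zero    = refl
    go (a ∷ p) (suc i) = go p i

  mul-congˡ : ∀ p {q r} → q ≋ r → mul p q ≋ mul p r
  mul-congˡ []      e = coeffwise λ _ → refl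
  mul-congˡ (a ∷ p) e = add-cong (scale-cong refl e) (∷-cong refl (mul-congˡ p e))

  mul-distribˡ : ∀ p q r → mul p (add q r) ≋ add (mul p q) (mul p r)
  mul-distribˡ p q r = coeffwise λ i → trans (go p i) (sym (coeff-add (mul p q) (mul p r) i))
    where
    go : ∀ p i → coeff (mul p (add q r)) i ≈ coeff (mul p q) i + coeff (mul p r) i
    go []      i       = sym (+-identityˡ _)
    go (a ∷ p) zero    = begin
      coeff (mul (a ∷ p) (add q r)) 0    ≈⟨ coeff-∷*-zero a p (add q r) ⟩
      a * coeff (add q r) 0              ≈⟨ *-congˡ (coeff-add q r 0) ⟩
      a * (coeff q 0 + coeff r 0)        ≈⟨ distribˡ _ _ _ ⟩
      a * coeff q 0 + a * coeff r 0      ≈⟨ +-cong (coeff-∷*-zero a p q) (coeff-∷*-zero a p r) ⟨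
      coeff (mul (a ∷ p) q) 0 + coeff (mul (a ∷ p) r) 0 ∎
    go (a ∷ p) (suc i) = begin
      coeff (mul (a ∷ p) (add q r)) (suc i)
        ≈⟨ coeff-∷*-suc a p (add q r) i ⟩
      a * coeff (add q r) (suc i) + coeff (mul p (add q r)) i
        ≈⟨ +-cong (*-congˡ (coeff-add q r (suc i))) (go p i) ⟩
      a * (coeff q (suc i) + coeff r (suc i)) + (coeff (mul p q) i + coeff (mul p r) i)
        ≈⟨ solve 5 (λ a b c m n → a :* (b :+ c) :+ (m :+ n) := (a :* b :+ m) :+ (a :* c :+ n))
             refl _ _ _ _ _ ⟩
      (a * coeff q (suc i) + coeff (mul p q) i) + (a * coeff r (suc i) + coeff (mul p r) i)
        ≈⟨ +-cong (coeff-∷*-suc a p q i) (coeff-∷*-suc a p r i) ⟨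
      coeff (mul (a ∷ p) q) (suc i) + coeff (mul (a ∷ p) r) (suc i) ∎

  -- Multiplication is defined by recursion on its left argument; this is the
  -- corresponding rule on the right, from which commutativity follows.

  mul-∷ʳ : ∀ p b q → mul p (b ∷ q) ≋ add (scale b p) (0# ∷ mul p q)
  mul-∷ʳ p b q = coeffwise λ i → trans (go p i) (sym (coeff-add (scale b p) (0# ∷ mul p q) i))
    where
    go : ∀ p i → coeff (mul p (b ∷ q)) i ≈ coeff (scale b p) i + coeff (0# ∷ mul p q) i
    go []      zero    = sym (+-identityˡ _)
    go []      (suc i) = sym (+-identityˡ _)
    go (a ∷ p) zero    = trans (coeff-∷*-zero a p (b ∷ q)) (trans (*-comm a b) (sym (+-identityʳ _)))
    go (a ∷ p) (suc zero) = begin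
      coeff (mul (a ∷ p) (b ∷ q)) 1
        ≈⟨ coeff-∷*-suc a p (b ∷ q) 0 ⟩
      a * coeff q 0 + coeff (mul p (b ∷ q)) 0
        ≈⟨ +-congˡ (go p 0) ⟩
      a * coeff q 0 + (coeff (scale b p) 0 + 0#)
        ≈⟨ solve 2 (λ x y → x :+ (y :+ con 0) := y :+ x) refl _ _ ⟩
      coeff (scale b p) 0 + a * coeff q 0
        ≈⟨ +-congˡ (coeff-∷*-zero a p q) ⟨
      coeff (scale b p) 0 + coeff (mul (a ∷ p) q) 0 ∎
    go (a ∷ p) (suc (suc i)) = begin
      coeff (mul (a ∷ p) (b ∷ q)) (suc (suc i))
        ≈⟨ coeff-∷*-suc a p (b ∷ q) (suc i) ⟩
      a * coeff q (suc i) + coeff (mul p (b ∷ q)) (suc i)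
        ≈⟨ +-congˡ (go p (suc i)) ⟩
      a * coeff q (suc i) + (coeff (scale b p) (suc i) + coeff (mul p q) i)
        ≈⟨ solve 3 (λ x y z → x :+ (y :+ z) := y :+ (x :+ z)) refl _ _ _ ⟩
      coeff (scale b p) (suc i) + (a * coeff q (suc i) + coeff (mul p q) i)
        ≈⟨ +-congˡ (coeff-∷*-suc a p q i) ⟨
      coeff (scale b p) (suc i) + coeff (mul (a ∷ p) q) (suc i) ∎

  open IsEquivalence ≋-isEquivalence
    renaming (refl to ≋-refl; sym to ≋-sym; trans to ≋-trans)

  mul-comm : ∀ p q → mul p q ≋ mul q p
  mul-comm p []      = mul-zeroʳ p
  mul-comm p (b ∷ q) = ≋-trans (mul-∷ʳ p b q)
    (add-cong ≋-refl (∷-cong refl (mul-comm p q)))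

  mul-cong : ∀ {p p′ q q′} → p ≋ p′ → q ≋ q′ → mul p q ≋ mul p′ q′
  mul-cong {p} {p′} {q} {q′} e f = ≋-trans (mul-congˡ p f)
    (≋-trans (mul-comm p q′) (≋-trans (mul-congˡ q′ e) (mul-comm q′ p′)))

  mul-distribʳ : ∀ p q r → mul (add q r) p ≋ add (mul q p) (mul r p)
  mul-distribʳ p q r = ≋-trans (mul-comm (add q r) p)
    (≋-trans (mul-distribˡ p q r) (add-cong (mul-comm p q) (mul-comm p r)))

  mul-scale : ∀ a p q → mul (scale a p) q ≋ scale a (mul p q)
  mul-scale a p q = coeffwise λ i → trans (go p i) (sym (coeff-scale a (mul p q) i))
    where
    go : ∀ p i → coeff (mul (scale a p) q) i ≈ a * coeff (mul p q) i
    go []      i       = sym (zeroʳ a)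
    go (b ∷ p) zero    = trans (coeff-∷*-zero (a * b) (scale a p) q)
      (trans (*-assoc _ _ _) (*-congˡ (sym (coeff-∷*-zero b p q))))
    go (b ∷ p) (suc i) = begin
      coeff (mul (scale a (b ∷ p)) q) (suc i)
        ≈⟨ coeff-∷*-suc (a * b) (scale a p) q i ⟩
      a * b * coeff q (suc i) + coeff (mul (scale a p) q) i
        ≈⟨ +-cong (*-assoc _ _ _) (go p i) ⟩
      a * (b * coeff q (suc i)) + a * coeff (mul p q) i
        ≈⟨ distribˡ _ _ _ ⟨
      a * (b * coeff q (suc i) + coeff (mul p q) i)
        ≈⟨ *-congˡ (coeff-∷*-suc b p q i) ⟨
      a * coeff (mul (b ∷ p) q) (suc i) ∎

  mul-shift : ∀ p q → mul (0# ∷ p) q ≋ 0# ∷ mul p q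
  mul-shift p q = coeffwise λ
    { zero    → trans (coeff-∷*-zero 0# p q) (zeroˡ _)
    ; (suc i) → trans (coeff-∷*-suc 0# p q i) (trans (+-congʳ (zeroˡ _)) (+-identityˡ _))
    }

  mul-assoc : ∀ p q r → mul (mul p q) r ≋ mul p (mul q r)
  mul-assoc []      q r = ≋-refl
  mul-assoc (a ∷ p) q r =
    ≋-trans (mul-distribʳ r (scale a q) (0# ∷ mul p q))
      (add-cong (mul-scale a q r)
        (≋-trans (mul-shift (mul p q) r) (∷-cong refl (mul-assoc p q r))))

  mul-identityˡ : ∀ p → mul (1# ∷ []) p ≋ p
  mul-identityˡ p = coeffwise λ
    { zero    → trans (coeff-∷*-zero 1# [] p) (*-identityˡ _)
    ; (suc i) → trans (coeff-∷*-suc 1# [] p i) (trans (+-identityʳ _) (*-identityˡ _))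
    }

  -- The laws are abstract: rings occur as parameters of types, and their
  -- normal forms would otherwise include these proofs.

  abstract
    isCommutativeRing′ : IsCommutativeRing _≋_ add mul (map -_) [] (1# ∷ [])
    isCommutativeRing′ = record
      { isRing = record
        { +-isAbelianGroup = record
          { isGroup = record
            { isMonoid = record
              { isSemigroup = record
                { isMagma = record { isEquivalence = ≋-isEquivalence ; ∙-cong = add-cong }
                ; assoc = λ p q r → coeffwise λ i → begin
                    coeff (add (add p q) r) i               ≈⟨ coeff-add (add p q) r i ⟩
                    coeff (add p q) i + coeff r i           ≈⟨ +-congʳ (coeff-add p q i) ⟩
                    coeff p i + coeff q i + coeff r i       ≈⟨ +-assoc _ _ _ ⟩
                    coeff p i + (coeff q i + coeff r i)     ≈⟨ +-congˡ (coeff-add q r i) ⟨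
                    coeff p i + coeff (add q r) i           ≈⟨ coeff-add p (add q r) i ⟨
                    coeff (add p (add q r)) i               ∎
                }
              ; identity = (λ p → ≋-refl) , λ p → coeffwise λ i →
                  trans (coeff-add p [] i) (+-identityʳ _)
              }
            ; inverse = (λ p → coeffwise λ i → trans (coeff-add (map -_ p) p i)
                          (trans (+-congʳ (coeff-negate p i)) (-‿inverseˡ _)))
                      , (λ p → coeffwise λ i → trans (coeff-add p (map -_ p) i)
                          (trans (+-congˡ (coeff-negate p i)) (-‿inverseʳ _)))
            ; ⁻¹-cong = λ {p} {q} e → coeffwise λ i → trans (coeff-negate p i)
                (trans (-‿cong (at e i)) (sym (coeff-negate q i)))
            }
          ; comm = λ p q → coeffwise λ i → trans (coeff-add p q i)
              (trans (+-comm _ _) (sym (coeff-add q p i)))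
          }
        ; *-cong = mul-cong
        ; *-assoc = mul-assoc
        ; *-identity = mul-identityˡ ,
            λ p → ≋-trans (mul-comm p (1# ∷ [])) (mul-identityˡ p)
        ; distrib = mul-distribˡ , mul-distribʳ
        }
      ; *-comm = mul-comm
      }

  asRing : Ring
  asRing = record
    { Carrier = List Carrier
    ; _≈_ = _≋_
    ; _+_ = add
    ; _*_ = mul
    ; -_  = map -_
    ; 0#  = []
    ; 1#  = 1# ∷ []
    ; isCommutativeRing = isCommutativeRing′
    }

polyRing : Ring → Ring
polyRing R = PolynomialRing.asRing R

-- Quotient rings and homomorphisms

module QuotientRing (R : Ring) (m : CommutativeRing.Carrier R) where
  open CommutativeRing R
  open RingProperties ring using (-‿distribˡ-*; -‿+-comm)
  open SetoidReasoning setoid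
  open SemiringSolver commutativeSemiring using (solve; _:=_; _:+_; _:*_)

  -- Congruence modulo m, in a form without subtraction: x + a * m = y + b * m.  The
  -- quotient ring has the carrier of R, with this relation as its equality.

  infix 4 _∼_
  record _∼_ (x y : Carrier) : Set where
    constructor congruent
    field
      left right : Carrier
      equation   : x + left * m ≈ y + right * m

  ∼-reflexive : ∀ {x y} → x ≈ y → x ∼ y
  ∼-reflexive x≈y = congruent 0# 0# (+-congʳ x≈y)

  ∼-sym : ∀ {x y} → x ∼ y → y ∼ x
  ∼-sym (congruent a b e) = congruent b a (sym e)

  ∼-trans : ∀ {x y z} → x ∼ y → y ∼ z → x ∼ z
  ∼-trans {x} {y} {z} (congruent a b e) (congruent c d f) = congruent (a + c) (b + d) (begin
    x + (a + c) * m
      ≈⟨ solve 4 (λ x a c m → x :+ (a :+ c) :* m := (x :+ a :* m) :+ c :* m) refl x a c m ⟩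
    x + a * m + c * m    ≈⟨ +-congʳ e ⟩
    y + b * m + c * m
      ≈⟨ solve 4 (λ y b c m → (y :+ b :* m) :+ c :* m := (y :+ c :* m) :+ b :* m) refl y b c m ⟩
    y + c * m + b * m    ≈⟨ +-congʳ f ⟩
    z + d * m + b * m
      ≈⟨ solve 4 (λ z d b m → (z :+ d :* m) :+ b :* m := z :+ (b :+ d) :* m) refl z d b m ⟩
    z + (b + d) * m      ∎)

  +-∼ʳ : ∀ {x y} z → x ∼ y → x + z ∼ y + z
  +-∼ʳ {x} {y} z (congruent a b e) = congruent a b (begin
    x + z + a * m      ≈⟨ solve 3 (λ x z t → (x :+ z) :+ t := (x :+ t) :+ z) refl x z (a * m) ⟩
    x + a * m + z      ≈⟨ +-congʳ e ⟩
    y + b * m + z      ≈⟨ solve 3 (λ x z t → (x :+ z) :+ t := (x :+ t) :+ z) refl y (b * m) z ⟩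
    y + z + b * m      ∎)

  *-∼ʳ : ∀ {x y} z → x ∼ y → x * z ∼ y * z
  *-∼ʳ {x} {y} z (congruent a b e) = congruent (a * z) (b * z) (begin
    x * z + a * z * m
      ≈⟨ solve 4 (λ x z a m → x :* z :+ a :* z :* m := (x :+ a :* m) :* z) refl x z a m ⟩
    (x + a * m) * z        ≈⟨ *-congʳ e ⟩
    (y + b * m) * z
      ≈⟨ solve 4 (λ x z a m → (x :+ a :* m) :* z := x :* z :+ a :* z :* m) refl y z b m ⟩
    y * z + b * z * m      ∎)

  +-∼ : ∀ {x x′ y y′} → x ∼ x′ → y ∼ y′ → x + y ∼ x′ + y′
  +-∼ {x} {x′} {y} {y′} e f = ∼-trans (+-∼ʳ y e) (∼-trans (∼-reflexive (+-comm x′ y))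
    (∼-trans (+-∼ʳ x′ f) (∼-reflexive (+-comm y′ x′))))

  *-∼ : ∀ {x x′ y y′} → x ∼ x′ → y ∼ y′ → x * y ∼ x′ * y′
  *-∼ {x} {x′} {y} {y′} e f = ∼-trans (*-∼ʳ y e) (∼-trans (∼-reflexive (*-comm x′ y))
    (∼-trans (*-∼ʳ x′ f) (∼-reflexive (*-comm y′ x′))))

  neg-∼ : ∀ {x y} → x ∼ y → - x ∼ - y
  neg-∼ {x} {y} (congruent a b e) = congruent (- a) (- b) (begin
    - x + - a * m       ≈⟨ +-congˡ (-‿distribˡ-* a m) ⟨
    - x + - (a * m)     ≈⟨ -‿+-comm x (a * m) ⟩
    - (x + a * m)       ≈⟨ -‿cong e ⟩
    - (y + b * m)       ≈⟨ -‿+-comm y (b * m) ⟨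
    - y + - (b * m)     ≈⟨ +-congˡ (-‿distribˡ-* b m) ⟩
    - y + - b * m       ∎)

  abstract
    isCommutativeRing′ : IsCommutativeRing _∼_ _+_ _*_ -_ 0# 1#
    isCommutativeRing′ = record
      { isRing = record
        { +-isAbelianGroup = record
          { isGroup = record
            { isMonoid = record
              { isSemigroup = record
                { isMagma = record
                  { isEquivalence = record
                    { refl = ∼-reflexive refl ; sym = ∼-sym ; trans = ∼-trans }
                  ; ∙-cong = +-∼
                  }
                ; assoc = λ x y z → ∼-reflexive (+-assoc x y z)
                }
              ; identity = (λ x → ∼-reflexive (+-identityˡ x))
                         , (λ x → ∼-reflexive (+-identityʳ x))
              }
            ; inverse = (λ x → ∼-reflexive (-‿inverseˡ x))
                      , (λ x → ∼-reflexive (-‿inverseʳ x))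
            ; ⁻¹-cong = neg-∼
            }
          ; comm = λ x y → ∼-reflexive (+-comm x y)
          }
        ; *-cong = *-∼
        ; *-assoc = λ x y z → ∼-reflexive (*-assoc x y z)
        ; *-identity = (λ x → ∼-reflexive (*-identityˡ x))
                     , (λ x → ∼-reflexive (*-identityʳ x))
        ; distrib = (λ x y z → ∼-reflexive (distribˡ x y z))
                  , (λ x y z → ∼-reflexive (distribʳ x y z))
        }
      ; *-comm = λ x y → ∼-reflexive (*-comm x y)
      }

  asRing : Ring
  asRing = record
    { Carrier = Carrier
    ; _≈_ = _∼_
    ; _+_ = _+_
    ; _*_ = _*_
    ; -_  = -_
    ; 0#  = 0#
    ; 1#  = 1#
    ; isCommutativeRing = isCommutativeRing′
    }

  ∼⇒∣ : ∀ {x y} → x ∼ y → ∃[ c ] c * m ≈ x - y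
  ∼⇒∣ {x} {y} (congruent a b e) = b - a , (begin
    (b - a) * m                      ≈⟨ distribʳ m b (- a) ⟩
    b * m + - a * m                  ≈⟨ +-congˡ (-‿distribˡ-* a m) ⟨
    b * m - a * m                    ≈⟨ +-congʳ (+-identityˡ _) ⟨
    0# + b * m - a * m               ≈⟨ +-congʳ (+-congʳ (-‿inverseʳ y)) ⟨
    y - y + b * m - a * m
      ≈⟨ +-congʳ (solve 3 (λ y z t → (y :+ z) :+ t := (y :+ t) :+ z) refl y (- y) (b * m)) ⟩
    y + b * m - y - a * m            ≈⟨ +-congʳ (+-congʳ e) ⟨
    x + a * m - y - a * m
      ≈⟨ solve 4 (λ x t z u → ((x :+ t) :+ z) :+ u := (x :+ z) :+ (t :+ u)) refl x (a * m) (- y) (- (a * m)) ⟩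
    (x - y) + (a * m - a * m)        ≈⟨ +-congˡ (-‿inverseʳ _) ⟩
    (x - y) + 0#                     ≈⟨ +-identityʳ _ ⟩
    x - y                            ∎)

  ∣⇒∼ : ∀ {x y} c → c * m ≈ x - y → x ∼ y
  ∣⇒∼ {x} {y} c e = congruent 0# c (begin
    x + 0# * m        ≈⟨ +-congˡ (zeroˡ m) ⟩
    x + 0#            ≈⟨ +-congˡ (-‿inverseˡ y) ⟨
    x + (- y + y)     ≈⟨ +-assoc x (- y) y ⟨
    x - y + y         ≈⟨ +-comm _ y ⟩
    y + (x - y)       ≈⟨ +-congˡ e ⟨
    y + c * m         ∎)

  m∼0 : m ∼ 0#
  m∼0 = congruent 0# 1# (begin
    m + 0# * m     ≈⟨ +-congˡ (zeroˡ m) ⟩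
    m + 0#         ≈⟨ +-comm m 0# ⟩
    0# + m         ≈⟨ +-congˡ (*-identityˡ m) ⟨
    0# + 1# * m    ∎)

  ∣⇒∼0 : ∀ {x} c → c * m ≈ x → x ∼ 0#
  ∣⇒∼0 {x} c e = congruent 0# c (trans (+-congˡ (zeroˡ m)) (trans (+-comm x 0#) (+-congˡ (sym e))))

-- Homomorphisms of commutative rings, bundled.  Compatibility with negation follows
-- (negate-homo).

record Hom (R S : Ring) : Set where
  private
    module R = CommutativeRing R
    module S = CommutativeRing S
  field
    ⟦_⟧    : R.Carrier → S.Carrier
    cong   : ∀ {x y} → x R.≈ y → ⟦ x ⟧ S.≈ ⟦ y ⟧
    +-homo : ∀ x y → ⟦ x R.+ y ⟧ S.≈ ⟦ x ⟧ S.+ ⟦ y ⟧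
    *-homo : ∀ x y → ⟦ x R.* y ⟧ S.≈ ⟦ x ⟧ S.* ⟦ y ⟧
    0-homo : ⟦ R.0# ⟧ S.≈ S.0#
    1-homo : ⟦ R.1# ⟧ S.≈ S.1#

  open Exp R.commutativeSemiring using () renaming (_^_ to _^R_)
  open Exp S.commutativeSemiring using () renaming (_^_ to _^S_)

  ^-homo : ∀ x n → ⟦ x ^R n ⟧ S.≈ ⟦ x ⟧ ^S n
  ^-homo x zero    = 1-homo
  ^-homo x (suc n) = S.trans (*-homo x (x ^R n)) (S.*-congˡ (^-homo x n))

infixr 9 _∘ₕ_
_∘ₕ_ : ∀ {R S T} → Hom S T → Hom R S → Hom R T
_∘ₕ_ {R} {S} {T} g f = record
  { ⟦_⟧    = λ x → g.⟦ f.⟦ x ⟧ ⟧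
  ; cong   = λ e → g.cong (f.cong e)
  ; +-homo = λ x y → T.trans (g.cong (f.+-homo x y)) (g.+-homo _ _)
  ; *-homo = λ x y → T.trans (g.cong (f.*-homo x y)) (g.*-homo _ _)
  ; 0-homo = T.trans (g.cong f.0-homo) g.0-homo
  ; 1-homo = T.trans (g.cong f.1-homo) g.1-homo
  }
  where
  module T = CommutativeRing T
  module f = Hom f
  module g = Hom g

quotientRing : (R : Ring) → CommutativeRing.Carrier R → Ring
quotientRing R m = QuotientRing.asRing R m

quotientMap : (R : Ring) (m : CommutativeRing.Carrier R) → Hom R (quotientRing R m)
quotientMap R m = record
  { ⟦_⟧ = λ x → x
  ; cong = ∼-reflexive
  ; +-homo = λ _ _ → ∼-reflexive refl
  ; *-homo = λ _ _ → ∼-reflexive refl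
  ; 0-homo = ∼-reflexive refl
  ; 1-homo = ∼-reflexive refl
  }
  where
  open CommutativeRing R
  open QuotientRing R m

quotientHom : ∀ {R S} (f : Hom R S) (m : CommutativeRing.Carrier R) →
              Hom (quotientRing R m) (quotientRing S (Hom.⟦_⟧ f m))
quotientHom {R} {S} f m = record
  { ⟦_⟧ = ⟦_⟧
  ; cong = λ { {x} {y} (R/m.congruent a b e) → congruent ⟦ a ⟧ ⟦ b ⟧
      (trans (expand x a) (trans (cong e) (sym (expand y b)))) }
  ; +-homo = λ x y → ∼-reflexive (+-homo x y)
  ; *-homo = λ x y → ∼-reflexive (*-homo x y)
  ; 0-homo = ∼-reflexive 0-homo
  ; 1-homo = ∼-reflexive 1-homo
  }
  where
  open Hom f
  open CommutativeRing S
  module R = CommutativeRing R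
  module R/m = QuotientRing R m
  open QuotientRing S ⟦ m ⟧
  expand : ∀ x a → ⟦ x ⟧ + ⟦ a ⟧ * ⟦ m ⟧ ≈ ⟦ x R.+ a R.* m ⟧
  expand x a = trans (+-congˡ (sym (*-homo a m))) (sym (+-homo x (a R.* m)))

-- The inclusion of R into R[X] as the constant polynomials.

constant : (R : Ring) → Hom R (polyRing R)
constant R = record
  { ⟦_⟧ = λ a → a ∷ []
  ; cong = λ e → ∷-cong e ≋-refl
  ; +-homo = λ _ _ → ≋-refl
  ; *-homo = λ a b → ∷-cong (sym (+-identityʳ (a * b))) ≋-refl
  ; 0-homo = coeffwise λ { zero → refl ; (suc _) → refl }
  ; 1-homo = ≋-refl
  }
  where
  open CommutativeRing R
  open PolynomialRing R
  open CommutativeRing (polyRing R) using () renaming (refl to ≋-refl)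

-- A homomorphism applied to all coefficients of a polynomial.

mapHom : ∀ {R S} → Hom R S → Hom (polyRing R) (polyRing S)
mapHom {R} {S} f = record
  { ⟦_⟧ = map ⟦_⟧
  ; cong = λ {p} {q} e → coeffwise λ i →
      trans (coeff-map p i) (trans (cong (R[t].at e i)) (sym (coeff-map q i)))
  ; +-homo = λ p q → add-homo p q
  ; *-homo = mul-homo
  ; 0-homo = ≋-refl
  ; 1-homo = ∷-cong 1-homo ≋-refl
  }
  where
  open Hom f
  module R = CommutativeRing R
  module R[t] = PolynomialRing R
  open CommutativeRing S
  open PolynomialRing S
  open CommutativeRing (polyRing S) using ()
    renaming (refl to ≋-refl; sym to ≋-sym; trans to ≋-trans)

  coeff-map : ∀ p i → coeff (map ⟦_⟧ p) i ≈ ⟦ R[t].coeff p i ⟧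
  coeff-map []      i       = sym 0-homo
  coeff-map (a ∷ p) zero    = refl
  coeff-map (a ∷ p) (suc i) = coeff-map p i

  add-homo : ∀ p q → map ⟦_⟧ (R[t].add p q) ≋ add (map ⟦_⟧ p) (map ⟦_⟧ q)
  add-homo []      q       = ≋-refl
  add-homo (a ∷ p) []      = ≋-refl
  add-homo (a ∷ p) (b ∷ q) = ∷-cong (+-homo a b) (add-homo p q)

  scale-homo : ∀ a p → map ⟦_⟧ (R[t].scale a p) ≋ scale ⟦ a ⟧ (map ⟦_⟧ p)
  scale-homo a []      = ≋-refl
  scale-homo a (b ∷ p) = ∷-cong (*-homo a b) (scale-homo a p)

  mul-homo : ∀ p q → map ⟦_⟧ (R[t].mul p q) ≋ mul (map ⟦_⟧ p) (map ⟦_⟧ q)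
  mul-homo []      q = ≋-refl
  mul-homo (a ∷ p) q = ≋-trans (add-homo (R[t].scale a q) (R.0# ∷ R[t].mul p q))
    (add-cong (scale-homo a q) (∷-cong 0-homo (mul-homo p q)))

identity : (R : Ring) → Hom R R
identity R = record
  { ⟦_⟧ = λ x → x
  ; cong = λ e → e
  ; +-homo = λ _ _ → refl
  ; *-homo = λ _ _ → refl
  ; 0-homo = refl
  ; 1-homo = refl
  }
  where open CommutativeRing R

-- Evaluation and division of polynomials

module Evaluation (R : Ring) where
  open CommutativeRing R hiding (zero)
  open PolynomialRing R
  open CommutativeRing asRing using ()
    renaming (refl to ≋-refl; sym to ≋-sym; trans to ≋-trans)
  open SetoidReasoning setoid
  open SemiringSolver commutativeSemiring using (solve; _:=_; _:+_; _:*_; con)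
  open Exp commutativeSemiring using (_^_)

  -- The value of a polynomial at x, by Horner's rule.

  ev : List Carrier → Carrier → Carrier
  ev []      x = 0#
  ev (a ∷ p) x = a + x * ev p x

  ev-zero : ∀ p x → p ≋ [] → ev p x ≈ 0#
  ev-zero []      x e = refl
  ev-zero (a ∷ p) x e = begin
    a + x * ev p x   ≈⟨ +-cong (at e 0) (*-congˡ (ev-zero p x (coeffwise (at e ∘ suc)))) ⟩
    0# + x * 0#      ≈⟨ +-identityˡ _ ⟩
    x * 0#           ≈⟨ zeroʳ x ⟩
    0#               ∎

  ev-cong : ∀ p q {x y} → p ≋ q → x ≈ y → ev p x ≈ ev q y
  ev-cong []      q       e f = sym (ev-zero q _ (≋-sym e))
  ev-cong (a ∷ p) []      e f = ev-zero (a ∷ p) _ e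
  ev-cong (a ∷ p) (b ∷ q) e f =
    +-cong (at e 0) (*-cong f (ev-cong p q (coeffwise (at e ∘ suc)) f))

  ev-add : ∀ p q x → ev (add p q) x ≈ ev p x + ev q x
  ev-add []      q       x = sym (+-identityˡ _)
  ev-add (a ∷ p) []      x = sym (+-identityʳ _)
  ev-add (a ∷ p) (b ∷ q) x = begin
    (a + b) + x * ev (add p q) x         ≈⟨ +-congˡ (*-congˡ (ev-add p q x)) ⟩
    (a + b) + x * (ev p x + ev q x)
      ≈⟨ solve 5 (λ a b x m n → (a :+ b) :+ x :* (m :+ n) := (a :+ x :* m) :+ (b :+ x :* n))
           refl a b x (ev p x) (ev q x) ⟩
    (a + x * ev p x) + (b + x * ev q x)  ∎

  -- X ^ n, as a list of n + 1 coefficients.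

  monomial : ℕ → List Carrier
  monomial zero    = 1# ∷ []
  monomial (suc n) = 0# ∷ monomial n

  ev-monomial : ∀ n x → ev (monomial n) x ≈ x ^ n
  ev-monomial zero    x = solve 1 (λ x → con 1 :+ x :* con 0 := con 1) refl x
  ev-monomial (suc n) x = trans (+-identityˡ _) (*-congˡ (ev-monomial n x))

  length-monomial : ∀ k → length (monomial k) ≡ suc k
  length-monomial zero    = ≡.refl
  length-monomial (suc k) = ≡.cong suc (length-monomial k)

  -- The quotient of c ∷ p by X - a, by synthetic division.  The constant term c
  -- affects the remainder ev (c ∷ p) a only.

  synthetic : Carrier → List Carrier → List Carrier
  synthetic a []      = []
  synthetic a (c ∷ p) = ev (c ∷ p) a ∷ synthetic a p

  length-synthetic : ∀ a p → length (synthetic a p) ≡ length p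
  length-synthetic a []      = ≡.refl
  length-synthetic a (c ∷ p) = ≡.cong suc (length-synthetic a p)

  synthetic-zero : ∀ a p → synthetic a p ≋ [] → p ≋ []
  synthetic-zero a []      e = e
  synthetic-zero a (c ∷ p) e = coeffwise λ { zero → c≈0 ; (suc i) → at p≋0 i }
    where
    p≋0 : p ≋ []
    p≋0 = synthetic-zero a p (coeffwise (at e ∘ suc))
    c≈0 : c ≈ 0#
    c≈0 = begin
      c               ≈⟨ solve 2 (λ c a → c := c :+ a :* con 0) refl c a ⟩
      c + a * 0#      ≈⟨ +-congˡ (*-congˡ (ev-zero p a p≋0)) ⟨
      c + a * ev p a  ≈⟨ at e 0 ⟩
      0#              ∎

  length-add : ∀ {n} p q → length p ≤ n → length q ≤ n → length (add p q) ≤ n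
  length-add []      q       l       l′       = l′
  length-add (a ∷ p) []      l       l′       = l
  length-add (a ∷ p) (b ∷ q) (s≤s l) (s≤s l′) = s≤s (length-add p q l l′)

  mul-constant : ∀ a p → mul (a ∷ []) p ≋ scale a p
  mul-constant a p = coeffwise λ i → trans (coeff-add (scale a p) (0# ∷ []) i)
    (trans (+-congˡ (0∷[]≈0 i)) (+-identityʳ _))
    where
    0∷[]≈0 : ∀ i → coeff (0# ∷ []) i ≈ 0#
    0∷[]≈0 zero    = refl
    0∷[]≈0 (suc i) = refl

  -- The list p has exactly d + 1 entries, and the last one is 1.  Fixing the length,
  -- rather than the polynomial up to equality, allows induction on d.

  data IsMonic : ℕ → List Carrier → Set where
    leading : ∀ {a} → a ≈ 1# → IsMonic 0 (a ∷ [])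
    _∷_     : ∀ {n p} a → IsMonic n p → IsMonic (suc n) (a ∷ p)

  monic-length : ∀ {n p} → IsMonic n p → length p ≡ suc n
  monic-length (leading _) = ≡.refl
  monic-length (a ∷ M)     = ≡.cong suc (monic-length M)

  monic-synthetic : ∀ a {n p} → IsMonic n p → IsMonic n (synthetic a p)
  monic-synthetic a (leading e) = leading (trans (+-congˡ (zeroʳ a)) (trans (+-identityʳ _) e))
  monic-synthetic a (b ∷ M)     = _ ∷ monic-synthetic a M

  monic-leading : ∀ {n p} → IsMonic n p → coeff p n ≈ 1#
  monic-leading (leading e) = e
  monic-leading (a ∷ M)     = monic-leading M

  coeff-beyond : ∀ p {i} → length p ≤ i → coeff p i ≈ 0#
  coeff-beyond []      _       = refl
  coeff-beyond (a ∷ p) (s≤s l) = coeff-beyond p l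

  X : List Carrier
  X = 0# ∷ 1# ∷ []

  mul-X : ∀ p → mul X p ≋ 0# ∷ p
  mul-X p = ≋-trans (mul-shift (1# ∷ []) p) (∷-cong refl (mul-identityˡ p))

  -- One step of the division by a monic polynomial: it removes the coefficient of X ^ d.

  reduce : ∀ {d P} → IsMonic d P → ∀ g → length g ≤ suc d →
           ∃₂ λ b r → length r ≤ d × g ≋ add (scale b P) r
  reduce {P = P} M [] _ = 0# , [] , z≤n , coeffwise λ i → sym (begin
    coeff (add (scale 0# P) []) i  ≈⟨ coeff-add (scale 0# P) [] i ⟩
    coeff (scale 0# P) i + 0#      ≈⟨ +-identityʳ _ ⟩
    coeff (scale 0# P) i           ≈⟨ coeff-scale 0# P i ⟩
    0# * coeff P i                 ≈⟨ zeroˡ _ ⟩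
    0#                             ∎)
  reduce (leading {a} e) (x ∷ []) _ = x , [] , z≤n , ∷-cong
    (trans (sym (*-identityʳ x)) (*-congˡ (sym e))) ≋-refl
  reduce (leading _) (_ ∷ _ ∷ _) (s≤s ())
  reduce (a ∷ M) (x ∷ g) (s≤s l) with reduce M g l
  ... | b , r , l′ , e = b , x - b * a ∷ r , s≤s l′ , ∷-cong (sym (begin
    b * a + (x - b * a)
      ≈⟨ solve 3 (λ t x u → t :+ (x :+ u) := x :+ (t :+ u)) refl (b * a) x (- (b * a)) ⟩
    x + (b * a - b * a)   ≈⟨ +-congˡ (-‿inverseʳ _) ⟩
    x + 0#                ≈⟨ +-identityʳ x ⟩
    x                     ∎)) e

  divide : ∀ {d P} → IsMonic d P → ∀ f →
           ∃₂ λ c r → length c ≡ length f × length r ≤ d × f ≋ add (mul c P) r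
  divide M [] = [] , [] , ≡.refl , z≤n , ≋-refl
  divide {P = P} M (a ∷ f) with divide M f
  ... | c , r , l , l′ , e with reduce M (a ∷ r) (s≤s l′)
  ...   | b , r′ , l″ , e′ = b ∷ c , r′ , ≡.cong suc l , l″ ,
    ≋-trans (∷-cong (sym (+-identityˡ a)) e)
      (≋-trans (add-cong {0# ∷ mul c P} ≋-refl e′)
        (≋-trans (≋-sym (add-assoc (0# ∷ mul c P) (scale b P) r′))
          (add-cong (add-comm (0# ∷ mul c P) (scale b P)) ≋-refl)))
    where open CommutativeRing asRing using () renaming (+-assoc to add-assoc; +-comm to add-comm)

  -- A multiple c * P of a monic polynomial without coefficients in degrees ≥ deg P
  -- has c = 0, over any commutative ring.

  monic-cancel : ∀ {d P} → IsMonic d P → ∀ c → (∀ i → d ≤ i → coeff (mul c P) i ≈ 0#) → c ≋ []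
  monic-cancel M [] _ = ≋-refl
  monic-cancel {d} {P} M (a ∷ c) e = coeffwise λ { zero → a≈0 ; (suc i) → at c≋0 i }
    where
    c≋0 : c ≋ []
    c≋0 = monic-cancel M c λ i d≤i → begin
      coeff (mul c P) i                            ≈⟨ +-identityˡ _ ⟨
      0# + coeff (mul c P) i                       ≈⟨ +-congʳ (zeroʳ a) ⟨
      a * 0# + coeff (mul c P) i
        ≈⟨ +-congʳ (*-congˡ (coeff-beyond P (ℕ.≤-trans (ℕ.≤-reflexive (monic-length M)) (s≤s d≤i)))) ⟨
      a * coeff P (suc i) + coeff (mul c P) i      ≈⟨ coeff-∷*-suc a c P i ⟨
      coeff (mul (a ∷ c) P) (suc i)                ≈⟨ e (suc i) (ℕ.m≤n⇒m≤1+n d≤i) ⟩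
      0#                                           ∎
    a≈0 : a ≈ 0#
    a≈0 = begin
      a                               ≈⟨ *-identityʳ a ⟨
      a * 1#                          ≈⟨ *-congˡ (monic-leading M) ⟨
      a * coeff P d                   ≈⟨ coeff-scale a P d ⟨
      coeff (scale a P) d             ≈⟨ +-identityʳ _ ⟨
      coeff (scale a P) d + 0#        ≈⟨ +-congˡ (0∷cP≋0 d) ⟨
      coeff (scale a P) d + coeff (0# ∷ mul c P) d ≈⟨ coeff-add (scale a P) (0# ∷ mul c P) d ⟨
      coeff (mul (a ∷ c) P) d         ≈⟨ e d ℕ.≤-refl ⟩
      0#                              ∎
      where
      0∷cP≋0 : ∀ i → coeff (0# ∷ mul c P) i ≈ 0#
      0∷cP≋0 zero    = refl
      0∷cP≋0 (suc i) = at (mul-cong {q = P} c≋0 ≋-refl) i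

  short-multiple : ∀ {d P} → IsMonic d P → ∀ c r → length r ≤ d → mul c P ≋ r → r ≋ []
  short-multiple {P = P} M c r l e = ≋-trans (≋-sym e) (mul-cong {q = P} c≋0 ≋-refl)
    where
    c≋0 : c ≋ []
    c≋0 = monic-cancel M c λ i d≤i → trans (at e i) (coeff-beyond r (ℕ.≤-trans l d≤i))

ev-homo : ∀ {R S} (f : Hom R S) → let open Hom f in ∀ p x →
          CommutativeRing._≈_ S ⟦ Evaluation.ev R p x ⟧ (Evaluation.ev S (map ⟦_⟧ p) ⟦ x ⟧)
ev-homo         f []      x = Hom.0-homo f
ev-homo {R} {S} f (a ∷ p) x =
  trans (+-homo a _) (+-congˡ (trans (*-homo x _) (*-congˡ (ev-homo f p x))))
  where
  open Hom f
  open CommutativeRing S hiding (zero)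

-- Every polynomial is its own value at the indeterminate.

ev-X : ∀ R p → PolynomialRing._≋_ R p
  (Evaluation.ev (polyRing R) (map (Hom.⟦_⟧ (constant R)) p) (Evaluation.X R))
ev-X R []      = CommutativeRing.refl (polyRing R)
ev-X R (a ∷ p) = ≋-sym (≋-trans
  (add-cong (≋-refl {a ∷ []}) (≋-trans (mul-cong (≋-refl {X}) (≋-sym (ev-X R p))) (mul-X p)))
  (∷-cong (+-identityʳ a) ≋-refl))
  where
  open CommutativeRing R hiding (zero)
  open PolynomialRing R
  open Evaluation R
  open CommutativeRing asRing using ()
    renaming (refl to ≋-refl; sym to ≋-sym; trans to ≋-trans)

-- p(X) - p(a) = (X - a) * g(X), for p = c ∷ p′ and the synthetic quotient g, without
-- subtraction, and at a point of any ring to which the coefficients are mapped.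

synthetic-division : ∀ {R S} (f : Hom R S) →
  let open Hom f; open Evaluation; open CommutativeRing S using (_≈_; _+_; _*_) in
  ∀ a c p x → ev S (map ⟦_⟧ (c ∷ p)) x + ⟦ a ⟧ * ev S (map ⟦_⟧ (synthetic R a p)) x ≈
              ⟦ ev R (c ∷ p) a ⟧ + x * ev S (map ⟦_⟧ (synthetic R a p)) x
synthetic-division {R} {S} f a c p x = go c p
  where
  open Hom f
  module R = CommutativeRing R
  open CommutativeRing S hiding (zero)
  open Evaluation R using (synthetic) renaming (ev to evR)
  open Evaluation S using () renaming (ev to evS)
  open SetoidReasoning setoid
  open SemiringSolver commutativeSemiring using (solve; _:=_; _:+_; _:*_; con)
  E G : List R.Carrier → Carrier
  E p = evS (map ⟦_⟧ p) x
  G p = E (synthetic a p)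
  value : ∀ c p → ⟦ evR (c ∷ p) a ⟧ ≈ ⟦ c ⟧ + ⟦ a ⟧ * ⟦ evR p a ⟧
  value c p = trans (+-homo _ _) (+-congˡ (*-homo _ _))
  go : ∀ c p → E (c ∷ p) + ⟦ a ⟧ * G p ≈ ⟦ evR (c ∷ p) a ⟧ + x * G p
  go c [] = sym (begin
    ⟦ evR (c ∷ []) a ⟧ + x * 0#          ≈⟨ +-congʳ (value c []) ⟩
    ⟦ c ⟧ + ⟦ a ⟧ * ⟦ R.0# ⟧ + x * 0#    ≈⟨ +-congʳ (+-congˡ (*-congˡ 0-homo)) ⟩
    ⟦ c ⟧ + ⟦ a ⟧ * 0# + x * 0#
      ≈⟨ solve 3 (λ c a x → (c :+ a :* con 0) :+ x :* con 0 := (c :+ x :* con 0) :+ a :* con 0) refl ⟦ c ⟧ ⟦ a ⟧ x ⟩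
    ⟦ c ⟧ + x * 0# + ⟦ a ⟧ * 0#          ∎)
  go c p@(b ∷ p′) = begin
    (⟦ c ⟧ + x * E p) + ⟦ a ⟧ * (v + x * G p′)
      ≈⟨ solve 6 (λ c x e a v g → (c :+ x :* e) :+ a :* (v :+ x :* g) := (c :+ a :* v) :+ x :* (e :+ a :* g))
           refl ⟦ c ⟧ x (E p) ⟦ a ⟧ v (G p′) ⟩
    (⟦ c ⟧ + ⟦ a ⟧ * v) + x * (E p + ⟦ a ⟧ * G p′) ≈⟨ +-cong (sym (value c p)) (*-congˡ (go b p′)) ⟩
    ⟦ evR (c ∷ p) a ⟧ + x * (v + x * G p′)       ∎
    where v = ⟦ evR p a ⟧

-- Roots of polynomials over fields

record IsField (R : Ring) : Set where
  open CommutativeRing R hiding (zero)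
  field
    1≉0     : ¬ (1# ≈ 0#)
    inverse : ∀ x → ¬ (x ≈ 0#) → ∃[ y ] x * y ≈ 1#

module Field {R : Ring} (isField : IsField R) where
  open CommutativeRing R hiding (zero)
  open IsField isField
  open PolynomialRing R
  open Evaluation R
  open RingProperties ring using (-‿distribˡ-*; x∙y⁻¹≈ε⇒x≈y; -1*x≈-x)
  open SetoidReasoning setoid
  open Exp commutativeSemiring using (_^_)

  *-cancel-0 : ∀ x y → ¬ (x ≈ 0#) → x * y ≈ 0# → y ≈ 0#
  *-cancel-0 x y x≉0 xy≈0 with inverse x x≉0
  ... | z , xz≈1 = begin
    y            ≈⟨ *-identityˡ y ⟨
    1# * y       ≈⟨ *-congʳ xz≈1 ⟨
    x * z * y    ≈⟨ *-congʳ (*-comm x z) ⟩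
    z * x * y    ≈⟨ *-assoc z x y ⟩
    z * (x * y)  ≈⟨ *-congˡ xy≈0 ⟩
    z * 0#       ≈⟨ zeroʳ z ⟩
    0#           ∎

  *-distinct-0 : ∀ x y z → ¬ (x ≈ y) → x * z ≈ y * z → z ≈ 0#
  *-distinct-0 x y z x≉y e = *-cancel-0 (x - y) z (λ d → x≉y (x∙y⁻¹≈ε⇒x≈y x y d)) (begin
    (x - y) * z       ≈⟨ distribʳ z x (- y) ⟩
    x * z + - y * z   ≈⟨ +-cong e (sym (-‿distribˡ-* y z)) ⟩
    y * z - y * z     ≈⟨ -‿inverseʳ _ ⟩
    0#                ∎)

  Distinct : ∀ {n} → (Fin n → Carrier) → Set
  Distinct a = ∀ i j → a i ≈ a j → i ≡ j

  -- The remaining roots are roots of the quotient by X - a zero.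

  synthetic-root : ∀ {n} (a : Fin (suc n) → Carrier) → Distinct a →
                   ∀ c p → (∀ i → ev (c ∷ p) (a i) ≈ 0#) →
                   ∀ i → ev (synthetic (a zero) p) (a (suc i)) ≈ 0#
  synthetic-root a inj c p e i = *-distinct-0 (a zero) (a (suc i)) _
    (λ eq → case inj zero (suc i) eq of λ ())
    (begin
      a zero * G                        ≈⟨ +-identityˡ _ ⟨
      0# + a zero * G                   ≈⟨ +-congʳ (e (suc i)) ⟨
      ev (c ∷ p) (a (suc i)) + a zero * G ≈⟨ division ⟩
      ev (c ∷ p) (a zero) + a (suc i) * G ≈⟨ +-congʳ (e zero) ⟩
      0# + a (suc i) * G                ≈⟨ +-identityˡ _ ⟩
      a (suc i) * G                     ∎)
    where
    G = ev (synthetic (a zero) p) (a (suc i))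
    division : ev (c ∷ p) (a (suc i)) + a zero * G ≈ ev (c ∷ p) (a zero) + a (suc i) * G
    division with synthetic-division (identity R) (a zero) c p (a (suc i))
    ... | eq rewrite map-id p | map-id (synthetic (a zero) p) = eq

  -- A polynomial with at most n coefficients and n distinct roots is zero.

  vanishing : ∀ {n} (a : Fin n → Carrier) → Distinct a →
              ∀ p → length p ≤ n → (∀ i → ev p (a i) ≈ 0#) → p ≋ []
  vanishing a inj [] _ e = coeffwise λ _ → refl
  vanishing {suc n} a inj (c ∷ p) (s≤s l) e = synthetic-zero (a zero) (c ∷ p)
    (coeffwise λ { zero → e zero ; (suc i) → at rest i })
    where
    rest : synthetic (a zero) p ≋ []
    rest = vanishing (a ∘ suc) (λ i j eq → suc-injective (inj (suc i) (suc j) eq))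
      (synthetic (a zero) p) (ℕ.≤-trans (ℕ.≤-reflexive (length-synthetic (a zero) p)) l)
      (synthetic-root a inj c p e)

  module _ {S : Ring} (f : Hom R S) where
    open Hom f
    private module S = CommutativeRing S
    open Sum S.*-commutativeMonoid using () renaming (sum to ∏)
    open RingProperties S.ring using () renaming (-‿distribˡ-* to S-distrib)
    private module SE = SetoidReasoning S.setoid

    -- A monic polynomial of degree n with n distinct roots in a field is the product
    -- of its linear factors, also when evaluated in a ring over that field.

    factorization : ∀ {n p} → IsMonic n p → (a : Fin n → Carrier) → Distinct a →
                    (∀ i → ev p (a i) ≈ 0#) →
                    ∀ x → Evaluation.ev S (map ⟦_⟧ p) x S.≈ ∏ (λ i → x S.- ⟦ a i ⟧)
    factorization (leading {c} e) a inj roots x =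
      S.trans (S.+-cong (S.trans (cong e) 1-homo) (S.zeroʳ x)) (S.+-identityʳ S.1#)
    factorization (_∷_ {p = p} c M) a inj roots x = SE.begin
      E                                         SE.≈⟨ S.+-identityʳ E ⟨
      E S.+ S.0#                                SE.≈⟨ S.+-congˡ (S.-‿inverseʳ _) ⟨
      E S.+ (⟦ a₀ ⟧ S.* G S.- ⟦ a₀ ⟧ S.* G)     SE.≈⟨ S.+-assoc _ _ _ ⟨
      E S.+ ⟦ a₀ ⟧ S.* G S.- ⟦ a₀ ⟧ S.* G       SE.≈⟨ S.+-congʳ (synthetic-division f a₀ c p x) ⟩
      ⟦ ev (c ∷ p) a₀ ⟧ S.+ x S.* G S.- ⟦ a₀ ⟧ S.* G
                                                SE.≈⟨ S.+-congʳ (S.+-congʳ (S.trans (cong (roots zero)) 0-homo)) ⟩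
      S.0# S.+ x S.* G S.- ⟦ a₀ ⟧ S.* G         SE.≈⟨ S.+-cong (S.+-identityˡ _) (S-distrib _ _) ⟩
      x S.* G S.+ S.- ⟦ a₀ ⟧ S.* G              SE.≈⟨ S.distribʳ G x _ ⟨
      (x S.- ⟦ a₀ ⟧) S.* G                      SE.≈⟨ S.*-congˡ rest ⟩
      (x S.- ⟦ a₀ ⟧) S.* ∏ (λ i → x S.- ⟦ a (suc i) ⟧)  SE.∎
      where
      a₀ = a zero
      E = Evaluation.ev S (map ⟦_⟧ (c ∷ p)) x
      G = Evaluation.ev S (map ⟦_⟧ (synthetic a₀ p)) x
      rest : G S.≈ ∏ (λ i → x S.- ⟦ a (suc i) ⟧)
      rest = factorization (monic-synthetic a₀ M) (a ∘ suc)
        (λ i j eq → suc-injective (inj (suc i) (suc j) eq)) (synthetic-root a inj c p roots) x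

  -- X ^ m - X has at most m roots, for m = k + 2.

  power-fixed-bound : ∀ k (a : Fin (suc (suc (suc k))) → Carrier) → Distinct a →
                      ¬ (∀ i → a i ^ suc (suc k) ≈ a i)
  power-fixed-bound k a inj e = 1≉0 (begin
    1#                                  ≈⟨ coeff-monomial k ⟨
    coeff (monomial k) k
      ≈⟨ at (vanishing a inj p (ℕ.≤-reflexive (≡.cong (2 ℕ.+_) (length-monomial k))) roots) (suc (suc k)) ⟩
    0#                                  ∎)
    where
    p = 0# ∷ - 1# ∷ monomial k
    coeff-monomial : ∀ k → coeff (monomial k) k ≈ 1#
    coeff-monomial zero    = refl
    coeff-monomial (suc k) = coeff-monomial k
    roots : ∀ i → ev p (a i) ≈ 0#
    roots i = begin
      0# + x * (- 1# + x * ev (monomial k) x) ≈⟨ +-identityˡ _ ⟩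
      x * (- 1# + x * ev (monomial k) x)      ≈⟨ *-congˡ (+-congˡ (*-congˡ (ev-monomial k x))) ⟩
      x * (- 1# + x ^ suc k)                  ≈⟨ distribˡ x _ _ ⟩
      x * - 1# + x ^ suc (suc k)              ≈⟨ +-cong (trans (*-comm x _) (-1*x≈-x x)) (e i) ⟩
      - x + x                                 ≈⟨ -‿inverseˡ x ⟩
      0#                                      ∎
      where x = a i

-- Finite fields

-- R has exactly N elements.

record Enumeration (R : Ring) (N : ℕ) : Set where
  open CommutativeRing R
  field
    element       : Fin N → Carrier
    index         : Carrier → Fin N
    element-index : ∀ x → element (index x) ≈ x
    injective     : ∀ i j → element i ≈ element j → i ≡ j

module Fermat (lem : ExcludedMiddle) {R : Ring} (isField : IsField R) where
  open CommutativeRing R hiding (zero)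
  open IsField isField
  open Field isField
  open SetoidReasoning setoid
  open Exp commutativeSemiring using (_^_)
  open Sum *-commutativeMonoid
    renaming (sum to ∏; sum-cong-≋ to ∏-cong; sum-remove to ∏-remove; sum-permute to ∏-permute;
              ∑-distrib-+ to ∏-distrib-*; sum-replicate to ∏-replicate)

  ∏-nonzero : ∀ {n} (t : Fin n → Carrier) → (∀ i → ¬ (t i ≈ 0#)) → ¬ (∏ t ≈ 0#)
  ∏-nonzero {zero}  t t≉0 = 1≉0
  ∏-nonzero {suc n} t t≉0 e =
    ∏-nonzero (t ∘ suc) (t≉0 ∘ suc) (*-cancel-0 (t zero) _ (t≉0 zero) e)

  -- y if y is nonzero, and 1 if y is zero.  The product of the unit parts of all
  -- elements is the product of the units.

  unitPart : Carrier → Carrier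
  unitPart y with lem (y ≈ 0#)
  ... | yes _ = 1#
  ... | no  _ = y

  unitPart-0 : ∀ {y} → y ≈ 0# → unitPart y ≈ 1#
  unitPart-0 {y} e with lem (y ≈ 0#)
  ... | yes _ = refl
  ... | no ¬e = contradiction e ¬e

  unitPart-unit : ∀ {y} → ¬ (y ≈ 0#) → unitPart y ≈ y
  unitPart-unit {y} ¬e with lem (y ≈ 0#)
  ... | yes e = contradiction e ¬e
  ... | no _  = refl

  unitPart-cong : ∀ {x y} → x ≈ y → unitPart x ≈ unitPart y
  unitPart-cong {x} {y} e with lem (y ≈ 0#)
  ... | yes y≈0 = unitPart-0 (trans e y≈0)
  ... | no  y≉0 = trans (unitPart-unit (λ x≈0 → y≉0 (trans (sym e) x≈0))) e

  module _ {N : ℕ} (enumeration : Enumeration R (suc N)) where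
    open Enumeration enumeration

    -- Multiplication by a unit permutes the elements.

    translation : ∀ x y → x * y ≈ 1# → Permutation (suc N) (suc N)
    translation x y xy≈1 = permutation
      (λ i → index (x * element i)) (λ i → index (y * element i))
      (λ i → inverts x y xy≈1 i) (λ i → inverts y x (trans (*-comm y x) xy≈1) i)
      where
      inverts : ∀ x y → x * y ≈ 1# → ∀ i → index (x * element (index (y * element i))) ≡ i
      inverts x y e i = injective _ i (begin
        element (index (x * element (index (y * element i)))) ≈⟨ element-index _ ⟩
        x * element (index (y * element i))                   ≈⟨ *-congˡ (element-index _) ⟩
        x * (y * element i)                                   ≈⟨ *-assoc x y _ ⟨
        x * y * element i                                     ≈⟨ *-congʳ e ⟩
        1# * element i                                        ≈⟨ *-identityˡ _ ⟩
        element i                                             ∎)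

    -- The units, enumerated by skipping the index of 0.

    units : Fin N → Carrier
    units j = element (punchIn (index 0#) j)

    units≉0 : ∀ j → ¬ (units j ≈ 0#)
    units≉0 j e = punchInᵢ≢i (index 0#) j (injective _ _ (trans e (sym (element-index 0#))))

    unit-power : ∀ x → ¬ (x ≈ 0#) → x ^ N ≈ 1#
    unit-power x x≉0 with inverse x x≉0
    ... | y , xy≈1 with inverse (∏ units) (∏-nonzero units units≉0)
    ... | z , pz≈1 = begin
      x ^ N                ≈⟨ *-identityʳ _ ⟨
      x ^ N * 1#           ≈⟨ *-congˡ pz≈1 ⟨
      x ^ N * (p * z)      ≈⟨ *-assoc _ _ _ ⟨
      x ^ N * p * z        ≈⟨ *-congʳ p≈xᴺp ⟨
      p * z                ≈⟨ pz≈1 ⟩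
      1#                   ∎
      where
      i₀ = index 0#
      p = ∏ units
      π = translation x y xy≈1
      -- The product over the units, after removing the factor 1 that stands for 0.
      removal : ∀ c → ¬ (c ≈ 0#) → ∏ (λ i → unitPart (c * element i)) ≈ ∏ (λ j → c * units j)
      removal c c≉0 = begin
        ∏ t                          ≈⟨ ∏-remove {i = i₀} t ⟩
        t i₀ * ∏ (removeAt t i₀)
          ≈⟨ *-congʳ (unitPart-0 (trans (*-congˡ (element-index 0#)) (zeroʳ c))) ⟩
        1# * ∏ (removeAt t i₀)       ≈⟨ *-identityˡ _ ⟩
        ∏ (removeAt t i₀)
          ≈⟨ ∏-cong (λ j → unitPart-unit λ e → units≉0 j (*-cancel-0 c _ c≉0 e)) ⟩
        ∏ (λ j → c * units j)        ∎
        where t = λ i → unitPart (c * element i)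
      p≈xᴺp : p ≈ x ^ N * p
      p≈xᴺp = begin
        ∏ units                               ≈⟨ ∏-cong (λ j → *-identityˡ (units j)) ⟨
        ∏ (λ j → 1# * units j)                ≈⟨ removal 1# 1≉0 ⟨
        ∏ (λ i → unitPart (1# * element i))
          ≈⟨ ∏-cong (λ i → unitPart-cong (*-identityˡ (element i))) ⟩
        ∏ (λ i → unitPart (element i))        ≈⟨ ∏-permute (λ i → unitPart (element i)) π ⟩
        ∏ (λ i → unitPart (element (index (x * element i))))
          ≈⟨ ∏-cong (λ i → unitPart-cong (element-index (x * element i))) ⟩
        ∏ (λ i → unitPart (x * element i))    ≈⟨ removal x x≉0 ⟩
        ∏ (λ j → x * units j)                 ≈⟨ ∏-distrib-* (λ _ → x) units ⟩
        ∏ (replicate N x) * ∏ units           ≈⟨ *-congʳ (∏-replicate N) ⟩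
        x ^ N * ∏ units                       ∎

  fermat : ∀ {N} → Enumeration R N → ∀ x → x ^ N ≈ x
  fermat {zero}  enumeration x = case Enumeration.index enumeration x of λ ()
  fermat {suc N} enumeration x with lem (x ≈ 0#)
  ... | yes x≈0 = trans (*-congʳ x≈0) (trans (zeroˡ _) (sym x≈0))
  ... | no  x≉0 = trans (*-congˡ (unit-power enumeration x x≉0)) (*-identityʳ x)

  -- A field has at least the two elements 0 and 1.

  enumeration-size : ∀ {N} → Enumeration R N → ∃[ k ] N ≡ suc (suc k)
  enumeration-size {0} E with Enumeration.index E 0#
  ... | ()
  enumeration-size {1} E = contradiction
    (trans (sym (element-index 1#))
      (trans (reflexive (≡.cong element (unique (index 1#) (index 0#)))) (element-index 0#))) 1≉0
    where
    open Enumeration E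
    unique : (i j : Fin 1) → i ≡ j
    unique zero zero = ≡.refl
  enumeration-size {suc (suc k)} E = k , ≡.refl

-- The q-th power map of a field K, where q = r + 1 and K has q distinct elements a i.
-- It is additive if it fixes every a i and every a i + 1; in the application, the a i
-- are the elements of a subfield with q elements.

module Frobenius (lem : ExcludedMiddle) {K : Ring} (isField : IsField K) {r : ℕ}
  (a : Fin (suc r) → CommutativeRing.Carrier K) (distinct : Field.Distinct isField a)
  where
  open CommutativeRing K hiding (zero)
  open IsField isField
  open Field isField
  open PolynomialRing K
  open Evaluation K
  open SetoidReasoning setoid
  open SemiringSolver commutativeSemiring using (solve; _:=_; _:+_; _:*_; con)
  open RingProperties ring using (x∙y⁻¹≈ε⇒x≈y; +-cancelˡ)
  open Exp commutativeSemiring using (_^_; ^-congˡ; ^-distrib-*)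

  q : ℕ
  q = suc r

  -- (X + 1) ^ n - X ^ n

  lowerTerms : ℕ → List Carrier
  lowerTerms zero    = []
  lowerTerms (suc n) = add (monomial n) (add (0# ∷ lowerTerms n) (lowerTerms n))

  [x+1]^n : ∀ n x → (x + 1#) ^ n ≈ x ^ n + ev (lowerTerms n) x
  [x+1]^n zero    x = sym (+-identityʳ 1#)
  [x+1]^n (suc n) x = begin
    (x + 1#) * (x + 1#) ^ n      ≈⟨ *-congˡ ([x+1]^n n x) ⟩
    (x + 1#) * (x ^ n + l)
      ≈⟨ solve 3 (λ x m l → (x :+ con 1) :* (m :+ l) := x :* m :+ (m :+ ((con 0 :+ x :* l) :+ l))) refl x (x ^ n) l ⟩
    x * x ^ n + (x ^ n + ((0# + x * l) + l))
      ≈⟨ +-congˡ (+-cong (ev-monomial n x) (ev-add (0# ∷ lowerTerms n) (lowerTerms n) x)) ⟨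
    x * x ^ n + (ev (monomial n) x + ev (add (0# ∷ lowerTerms n) (lowerTerms n)) x)
      ≈⟨ +-congˡ (ev-add (monomial n) _ x) ⟨
    x * x ^ n + ev (lowerTerms (suc n)) x ∎
    where l = ev (lowerTerms n) x

  length-lowerTerms : ∀ n → length (lowerTerms n) ≤ n
  length-lowerTerms zero    = z≤n
  length-lowerTerms (suc n) = length-add (monomial n) _ (ℕ.≤-reflexive (length-monomial n))
    (length-add (0# ∷ lowerTerms n) (lowerTerms n)
      (s≤s (length-lowerTerms n)) (ℕ.m≤n⇒m≤1+n (length-lowerTerms n)))

  module _ (fixed : ∀ i → a i ^ q ≈ a i) (fixed+1 : ∀ i → (a i + 1#) ^ q ≈ a i + 1#) where

    -- (X + 1) ^ q - X ^ q - 1 has q coefficients and vanishes at every a i.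

    [x+1]^q : ∀ x → (x + 1#) ^ q ≈ x ^ q + 1#
    [x+1]^q x = trans ([x+1]^n q x)
      (+-congˡ (x∙y⁻¹≈ε⇒x≈y _ _ (trans (sym (value x)) (ev-zero p x p≋0))))
      where
      p : List Carrier
      p = add (lowerTerms q) (- 1# ∷ [])
      value : ∀ x → ev p x ≈ ev (lowerTerms q) x - 1#
      value x = trans (ev-add (lowerTerms q) (- 1# ∷ []) x)
        (+-congˡ (trans (+-congˡ (zeroʳ x)) (+-identityʳ _)))
      p≋0 : p ≋ []
      p≋0 = vanishing a distinct p
        (length-add (lowerTerms q) (- 1# ∷ []) (length-lowerTerms q) (s≤s z≤n))
        λ i → trans (value (a i)) (trans (+-congʳ (+-cancelˡ (a i) _ _ (begin
          a i + ev (lowerTerms q) (a i)        ≈⟨ +-congʳ (fixed i) ⟨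
          a i ^ q + ev (lowerTerms q) (a i)    ≈⟨ [x+1]^n q (a i) ⟨
          (a i + 1#) ^ q                       ≈⟨ fixed+1 i ⟩
          a i + 1#                             ∎))) (-‿inverseʳ 1#))

    [x+y]^q : ∀ x y → (x + y) ^ q ≈ x ^ q + y ^ q
    [x+y]^q x y with lem (y ≈ 0#)
    ... | yes y≈0 = begin
      (x + y) ^ q      ≈⟨ ^-congˡ q (trans (+-congˡ y≈0) (+-identityʳ x)) ⟩
      x ^ q            ≈⟨ +-identityʳ _ ⟨
      x ^ q + 0#       ≈⟨ +-congˡ (trans (^-congˡ q y≈0) (zeroˡ _)) ⟨
      x ^ q + y ^ q    ∎
    ... | no  y≉0 with inverse y y≉0
    ...   | z , yz≈1 = begin
      (x + y) ^ q                     ≈⟨ ^-congˡ q (+-congʳ xzy≈x) ⟨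
      (x * z * y + y) ^ q
        ≈⟨ ^-congˡ q (solve 2 (λ u y → u :* y :+ y := (u :+ con 1) :* y) refl (x * z) y) ⟩
      ((x * z + 1#) * y) ^ q          ≈⟨ ^-distrib-* _ y q ⟩
      (x * z + 1#) ^ q * y ^ q        ≈⟨ *-congʳ ([x+1]^q (x * z)) ⟩
      ((x * z) ^ q + 1#) * y ^ q      ≈⟨ solve 2 (λ u v → (u :+ con 1) :* v := u :* v :+ v) refl _ _ ⟩
      (x * z) ^ q * y ^ q + y ^ q     ≈⟨ +-congʳ (^-distrib-* _ y q) ⟨
      (x * z * y) ^ q + y ^ q         ≈⟨ +-congʳ (^-congˡ q xzy≈x) ⟩
      x ^ q + y ^ q                   ∎
      where
      xzy≈x : x * z * y ≈ x
      xzy≈x = trans (*-assoc x z y) (trans (*-congˡ (trans (*-comm z y) yz≈1)) (*-identityʳ x))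

    frobenius : Hom K K
    frobenius = record
      { ⟦_⟧    = _^ q
      ; cong   = ^-congˡ q
      ; +-homo = [x+y]^q
      ; *-homo = λ x y → ^-distrib-* x y q
      ; 0-homo = zeroˡ _
      ; 1-homo = 1^n q
      }
      where
      1^n : ∀ n → 1# ^ n ≈ 1#
      1^n zero    = refl
      1^n (suc n) = trans (*-identityˡ _) (1^n n)

    -- The fixed elements are the a i: one more would be a (q + 1)-st root of X ^ q - X.

    module _ {k : ℕ} (r≡ : r ≡ suc k) where
      fixed-by-frobenius : ∀ x → x ^ q ≈ x → ∃[ i ] a i ≈ x
      fixed-by-frobenius x xᵠ≈x with lem (∃[ i ] a i ≈ x)
      ... | yes i = i
      ... | no ∄i = contradiction roots (bound b b-distinct)
        where
        bound : (b : Fin (suc q) → Carrier) → Distinct b → ¬ (∀ i → b i ^ q ≈ b i)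
        bound = ≡.subst
          (λ r → (b : Fin (suc (suc r)) → Carrier) → Distinct b → ¬ (∀ i → b i ^ suc r ≈ b i))
          (≡.sym r≡) (power-fixed-bound k)
        b : Fin (suc q) → Carrier
        b zero    = x
        b (suc i) = a i
        b-distinct : Distinct b
        b-distinct zero    zero    _ = ≡.refl
        b-distinct zero    (suc j) e = contradiction (j , sym e) ∄i
        b-distinct (suc i) zero    e = contradiction (i , e) ∄i
        b-distinct (suc i) (suc j) e = ≡.cong suc (distinct i j e)
        roots : ∀ i → b i ^ q ≈ b i
        roots zero    = xᵠ≈x
        roots (suc i) = fixed i

-- Residue fields of irreducible polynomials

coeff-tabulate : ∀ R {n} (g : Fin n → CommutativeRing.Carrier R) i →
                 PolynomialRing.coeff R (tabulate g) (toℕ i) ≡ g i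
coeff-tabulate R g zero    = ≡.refl
coeff-tabulate R g (suc i) = coeff-tabulate R (g ∘ suc) i

≋-tabulate : ∀ R n p → length p ≤ n → let open PolynomialRing R in
             p ≋ tabulate {n = n} (λ i → coeff p (toℕ i))
≋-tabulate R n p l = coeffwise (go n p l)
  where
  open CommutativeRing R using (_≈_; refl; 0#; sym)
  open PolynomialRing R
  zeros : ∀ n i → coeff (tabulate {n = n} (λ _ → 0#)) i ≈ 0#
  zeros zero    i       = refl
  zeros (suc n) zero    = refl
  zeros (suc n) (suc i) = zeros n i
  go : ∀ n p → length p ≤ n → ∀ i → coeff p i ≈ coeff (tabulate {n = n} (λ i → coeff p (toℕ i))) i
  go n       []      l       i       = sym (zeros n i)
  go (suc n) (a ∷ p) (s≤s l) zero    = refl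
  go (suc n) (a ∷ p) (s≤s l) (suc i) = go n p l i

-- R[t]/P for a monic polynomial P of positive degree d over a commutative ring R.

module MonicQuotient (R : Ring) {d-1 : ℕ} {P : List (CommutativeRing.Carrier R)}
                     (monic : Evaluation.IsMonic R (suc d-1) P) where
  open CommutativeRing R hiding (zero)
  open PolynomialRing R
  open Evaluation R
  open CommutativeRing (polyRing R) using ()
    renaming (refl to ≋-refl)
  open QuotientRing (polyRing R) P

  d : ℕ
  d = suc d-1

  R[t]/P : Ring
  R[t]/P = quotientRing (polyRing R) P

  inclusion : Hom R R[t]/P
  inclusion = quotientMap (polyRing R) P ∘ₕ constant R

  -- Polynomials with at most d coefficients represent distinct classes.

  short-congruent : ∀ f g → length f ≤ d → length g ≤ d → f ∼ g → f ≋ g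
  short-congruent f g l l′ f∼g = let (c , cP≋f-g) = ∼⇒∣ f∼g in
    x∙y⁻¹≈ε⇒x≈y f g (short-multiple monic c _
      (length-add f _ l (ℕ.≤-trans (ℕ.≤-reflexive (length-map _ g)) l′)) cP≋f-g)
    where open RingProperties (CommutativeRing.ring (polyRing R)) using (x∙y⁻¹≈ε⇒x≈y)

  inclusion-injective : ∀ {a b} → a ∷ [] ∼ b ∷ [] → a ≈ b
  inclusion-injective {a} {b} e = at (short-congruent (a ∷ []) (b ∷ []) (s≤s z≤n) (s≤s z≤n) e) 0

  remainder : ∀ f → ∃[ r ] length r ≤ d × f ∼ r
  remainder f with divide monic f
  ... | c , r , _ , l , e = r , l , ∼-trans (∼-reflexive e)
    (∼-trans (+-∼ (∣⇒∼0 {mul c P} c ≋-refl) (∼-reflexive ≋-refl)) (∼-reflexive ≋-refl))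

  -- The class of p is the value of p at the class of t.

  ev-indeterminate : ∀ p → p ∼ Evaluation.ev R[t]/P (map (Hom.⟦_⟧ inclusion) p) X
  ev-indeterminate p with ev-homo (quotientMap (polyRing R) P) (map (Hom.⟦_⟧ (constant R)) p) X
  ... | e rewrite map-id (map (Hom.⟦_⟧ (constant R)) p) = ∼-trans (∼-reflexive (ev-X R p)) e

IsUnit : (R : Ring) → CommutativeRing.Carrier R → Set
IsUnit R x = ∃[ y ] y * x ≈ 1#
  where open CommutativeRing R

-- The splitting condition in irreducibility, for factors with at most as many
-- coefficients as P.  With the bound, the condition passes to the components of an
-- ultraproduct; factors found by division satisfy it.

SplitsTrivially : (R : Ring) → List (CommutativeRing.Carrier R) → Set
SplitsTrivially R P = ∀ f g → length f ≤ length P → length g ≤ length P →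
  P ≋ mul f g → IsUnit (polyRing R) f ⊎ IsUnit (polyRing R) g
  where open PolynomialRing R

module Inverses (R : Ring) where
  open CommutativeRing R
  open RingProperties ring using (+-inverseˡ-unique; -‿distribˡ-*; -‿distribʳ-*; -‿involutive)
  open SetoidReasoning setoid
  open SemiringSolver commutativeSemiring using (solve; _:=_; _:*_)

  product-inverse : ∀ f a z r g → f ≈ a * r → a * z ≈ 1# → r * g ≈ 1# → f * (z * g) ≈ 1#
  product-inverse f a z r g f≈ar az≈1 rg≈1 = begin
    f * (z * g)        ≈⟨ *-congʳ f≈ar ⟩
    a * r * (z * g)    ≈⟨ solve 4 (λ a r g z → a :* r :* (z :* g) := a :* z :* (r :* g)) refl a r g z ⟩
    a * z * (r * g)    ≈⟨ *-cong az≈1 rg≈1 ⟩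
    1# * 1#            ≈⟨ *-identityˡ 1# ⟩
    1#                 ∎

  -- If c * f = - a * r with a and r invertible, then f is invertible.

  relation-inverse : ∀ c f a z r g → c * f + a * r ≈ 0# → a * z ≈ 1# → r * g ≈ 1# →
                     f * (c * (- z * g)) ≈ 1#
  relation-inverse c f a z r g relation az≈1 rg≈1 = begin
    f * (c * (- z * g))
      ≈⟨ solve 4 (λ f c g w → f :* (c :* (w :* g)) := c :* f :* (w :* g)) refl f c g (- z) ⟩
    c * f * (- z * g)       ≈⟨ product-inverse (c * f) (- a) (- z) r g cf≈-ar -a*-z≈1 rg≈1 ⟩
    1#                      ∎
    where
    cf≈-ar : c * f ≈ - a * r
    cf≈-ar = trans (+-inverseˡ-unique _ _ relation) (-‿distribˡ-* a r)
    -a*-z≈1 : - a * - z ≈ 1#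
    -a*-z≈1 = begin
      - a * - z       ≈⟨ -‿distribˡ-* a (- z) ⟨
      - (a * - z)     ≈⟨ -‿cong (-‿distribʳ-* a z) ⟨
      - (- (a * z))   ≈⟨ -‿involutive _ ⟩
      a * z           ≈⟨ az≈1 ⟩
      1#              ∎

module ResidueField (lem : ExcludedMiddle) {k : Ring} (k-isField : IsField k)
  {d-1 : ℕ} {P : List (CommutativeRing.Carrier k)}
  (monic : Evaluation.IsMonic k (suc d-1) P) (splits : SplitsTrivially k P) where
  open CommutativeRing k hiding (zero)
  open IsField k-isField
  open PolynomialRing k
  open Evaluation k
  module k[t] = CommutativeRing (polyRing k)
  open k[t] using () renaming (refl to ≋-refl; sym to ≋-sym; trans to ≋-trans)
  open QuotientRing (polyRing k) P
  open MonicQuotient k monic public renaming (R[t]/P to K)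
  module K = CommutativeRing K

  -- f is zero, or a nonzero scalar times a monic polynomial.

  data Normalized (f : List Carrier) : Set where
    zero   : f ≋ [] → Normalized f
    scaled : ∀ {m a f′} → m < length f → ¬ (a ≈ 0#) → IsMonic m f′ →
            f ≋ mul (a ∷ []) f′ → Normalized f

  normalize : ∀ f → Normalized f
  normalize [] = zero ≋-refl
  normalize (c ∷ p) with normalize p
  ... | scaled {a = a} {f′} l a≉0 M e with inverse a a≉0
  ...   | z , az≈1 = scaled {a = a} (s≤s l) a≉0 (z * c ∷ M)
    (≋-trans (∷-cong (sym (trans (sym (*-assoc a z c)) (trans (*-congʳ az≈1) (*-identityˡ c))))
      (≋-trans e (mul-constant a f′)))
      (≋-sym (mul-constant a (z * c ∷ f′))))
  normalize (c ∷ p) | zero p≋0 with lem (c ≈ 0#)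
  ... | yes c≈0 = zero (coeffwise λ { zero → c≈0 ; (suc i) → at p≋0 i })
  ... | no  c≉0 = scaled {a = c} {1# ∷ []} (s≤s z≤n) c≉0 (leading refl)
    (≋-trans (∷-cong (sym (*-identityʳ c)) p≋0) (≋-sym (mul-constant c (1# ∷ []))))

  scalar-inverse : ∀ {a z} → a * z ≈ 1# → (a ∷ []) K.* (z ∷ []) K.≈ K.1#
  scalar-inverse {a} {z} e = K.trans (K.sym (Hom.*-homo inclusion a z)) (Hom.cong inclusion e)

  -- A monic f of degree m < d is invertible modulo P, by induction on a bound n for m.
  -- Write P = c * f + r with deg r < m.  If r = 0, then f is a unit, since P is
  -- irreducible; otherwise r is invertible by induction, and c * f = - r modulo P.

  monic-invertible : ∀ n {m f} → m < n → m < d → IsMonic m f → ∃[ g ] f K.* g K.≈ K.1#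
  monic-invertible (suc n) {m} {f} (s≤s m≤n) m<d M with divide M P
  ... | c , r , lc , lr , P≋cf+r with normalize r
  ...   | zero r≋0 = byIrreducibility
    (splits c f (ℕ.≤-reflexive lc)
      (ℕ.≤-trans (ℕ.≤-reflexive (monic-length M)) (ℕ.≤-trans m<d
        (ℕ.≤-trans (ℕ.n≤1+n d) (ℕ.≤-reflexive (≡.sym (monic-length monic))))))
      P≋cf)
    where
    P≋cf : P ≋ mul c f
    P≋cf = ≋-trans P≋cf+r (≋-trans (add-cong (≋-refl {mul c f}) r≋0) (k[t].+-identityʳ (mul c f)))
    byIrreducibility : IsUnit (polyRing k) c ⊎ IsUnit (polyRing k) f → ∃[ g ] f K.* g K.≈ K.1#
    byIrreducibility (inj₂ (g , e)) = g , ∼-reflexive (≋-trans (mul-comm f g) e)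
    byIrreducibility (inj₁ (h , e)) = contradiction
      (trans (sym (monic-leading M)) (at (short-multiple monic h f
        (ℕ.≤-trans (ℕ.≤-reflexive (monic-length M)) m<d) hP≋f) m)) 1≉0
      where
      -- f would be a multiple of P of smaller degree.
      hP≋f : mul h P ≋ f
      hP≋f = ≋-trans (mul-cong (≋-refl {h}) P≋cf) (≋-trans (≋-sym (mul-assoc h c f))
        (≋-trans (mul-cong e (≋-refl {f})) (mul-identityˡ f)))
  ...   | scaled {m′} {a} {r′} l a≉0 M′ r≋ar′
    with monic-invertible n (ℕ.≤-trans l (ℕ.≤-trans lr m≤n)) (ℕ.≤-trans l (ℕ.≤-trans lr (ℕ.<⇒≤ m<d))) M′
       | inverse a a≉0
  ...     | g , r′g≈1 | z , az≈1 = _ , inverse-of-f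
    where
    relation : c K.* f K.+ (a ∷ []) K.* r′ K.≈ K.0#
    relation = ∼-trans (∼-sym (∼-reflexive (≋-trans P≋cf+r (add-cong (≋-refl {mul c f}) r≋ar′)))) m∼0
    inverse-of-f = Inverses.relation-inverse K c f (a ∷ []) (z ∷ []) r′ g relation (scalar-inverse az≈1) r′g≈1

  K-1≉0 : ¬ (K.1# K.≈ K.0#)
  K-1≉0 e = 1≉0 (inclusion-injective (∼-trans e (∼-sym (Hom.0-homo inclusion))))

  K-inverse : ∀ f → ¬ (f K.≈ K.0#) → ∃[ g ] f K.* g K.≈ K.1#
  K-inverse f f≉0 = let (r , l , f∼r) = remainder f in byRemainder r l f∼r (normalize r)
    where
    byRemainder : ∀ r → length r ≤ d → f K.≈ r → Normalized r → ∃[ g ] f K.* g K.≈ K.1#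
    byRemainder r l f∼r (zero r≋0) = contradiction (∼-trans f∼r (∼-reflexive r≋0)) f≉0
    byRemainder r l f∼r (scaled {m} {a} {r′} m<l a≉0 M e) =
      let (z , az≈1)  = inverse a a≉0
          (g , r′g≈1) = monic-invertible (suc m) ℕ.≤-refl (ℕ.≤-trans m<l l) M
      in _ , Inverses.product-inverse K f (a ∷ []) (z ∷ []) r′ g
               (∼-trans f∼r (∼-reflexive e)) (scalar-inverse az≈1) r′g≈1

  K-isField : IsField K
  K-isField = record { 1≉0 = K-1≉0 ; inverse = K-inverse }

  module _ {q : ℕ} (enumeration : Enumeration k q) where
    open Enumeration enumeration

    -- The classes correspond to their remainders, that is, to functions Fin d → Fin q.

    residues : Enumeration K (q ℕ.^ d)
    residues = record
      { element = element′
      ; index = λ f → funToFin (digits f)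
      ; element-index = λ f → let (r , l , f∼r) = remainder f in
          K.sym (K.trans f∼r (∼-reflexive (≋-trans (≋-tabulate k d r l)
            (tabulate-cong λ i → trans (sym (element-index _))
              (reflexive (≡.cong element (≡.sym (finToFun-funToFin (digits f) i))))))))
      ; injective = λ i j e → ≡.trans (≡.sym (funToFin-finToFin {d} {q} i))
          (≡.trans (funToFin-cong (λ s → injective _ _ (coefficients i j e s))) (funToFin-finToFin {d} {q} j))
      }
      where
      element′ : Fin (q ℕ.^ d) → List Carrier
      element′ i = tabulate {n = d} (λ s → element (finToFun i s))
      digits : List Carrier → Fin d → Fin q
      digits f s = index (coeff (proj₁ (remainder f)) (toℕ s))
      tabulate-cong : ∀ {n} {g h : Fin n → Carrier} → (∀ i → g i ≈ h i) → tabulate g ≋ tabulate h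
      tabulate-cong {zero}  e = ≋-refl
      tabulate-cong {suc n} e = ∷-cong (e zero) (tabulate-cong (e ∘ suc))
      funToFin-cong : ∀ {n} {g h : Fin n → Fin q} → (∀ i → g i ≡ h i) → funToFin g ≡ funToFin h
      funToFin-cong {zero}  e = ≡.refl
      funToFin-cong {suc n} e = ≡.cong₂ combine (e zero) (funToFin-cong (e ∘ suc))
      coefficients : ∀ i j → element′ i K.≈ element′ j → ∀ s → element (finToFun i s) ≈ element (finToFun j s)
      coefficients i j e s = trans (reflexive (≡.sym (coeff-tabulate k (digit i) s)))
        (trans (at (short-congruent (element′ i) (element′ j)
            (ℕ.≤-reflexive (length-tabulate (digit i))) (ℕ.≤-reflexive (length-tabulate (digit j))) e) (toℕ s))
          (reflexive (coeff-tabulate k (digit j) s)))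
        where
        digit : Fin (q ℕ.^ d) → Fin d → Carrier
        digit i s = element (finToFun i s)

-- Conjugates and norms

module GeometricPower (R : Ring) where
  open CommutativeRing R hiding (zero)
  open SetoidReasoning setoid
  open Exp commutativeSemiring using (_^_; ^-congˡ; ^-assocʳ)
  open Sum *-commutativeMonoid using () renaming (sum to ∏; sum-cong-≋ to ∏-cong)

  ^-geometric : ∀ q d x → x ^ geometric q d ≈ ∏ {d} (λ i → x ^ (q ℕ.^ toℕ i))
  ^-geometric q zero    x = refl
  ^-geometric q (suc d) x = *-cong (sym (*-identityʳ x)) (begin
    x ^ (q ℕ.* geometric q d)                 ≈⟨ ^-assocʳ x q _ ⟨
    (x ^ q) ^ geometric q d                   ≈⟨ ^-geometric q d (x ^ q) ⟩
    ∏ {d} (λ i → (x ^ q) ^ (q ℕ.^ toℕ i))     ≈⟨ ∏-cong {d} (λ i → ^-assocʳ x q _) ⟩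
    ∏ {d} (λ i → x ^ (q ℕ.* q ℕ.^ toℕ i))     ∎)

monic-map : ∀ {R S} (f : Hom R S) {n p} → Evaluation.IsMonic R n p →
            Evaluation.IsMonic S n (map (Hom.⟦_⟧ f) p)
monic-map {R} {S} f (Evaluation.leading e) = Evaluation.leading (trans (Hom.cong f e) (Hom.1-homo f))
  where open CommutativeRing S using (trans)
monic-map {R} {S} f (a Evaluation.∷ M) = Hom.⟦_⟧ f a Evaluation.∷ monic-map f M

map-fixed : ∀ {k K : Ring} (ι : Hom k K) (ψ : Hom K K) →
            let open CommutativeRing K using (_≈_); open Hom in
            (∀ b → ⟦ ψ ⟧ (⟦ ι ⟧ b) ≈ ⟦ ι ⟧ b) →
            ∀ p → PolynomialRing._≋_ K (map ⟦ ψ ⟧ (map ⟦ ι ⟧ p)) (map ⟦ ι ⟧ p)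
map-fixed {k} {K} ι ψ fixed []      = CommutativeRing.refl (polyRing K)
map-fixed {k} {K} ι ψ fixed (a ∷ p) = PolynomialRing.∷-cong K (fixed a) (map-fixed ι ψ fixed p)

-- The iterates of the q-th power map, as homomorphisms.

module Iterate {K : Ring} (q : ℕ) where
  open CommutativeRing K
  open Exp commutativeSemiring using (_^_; ^-congˡ; ^-congʳ; ^-assocʳ)

  iterate : Hom K K → ℕ → Hom K K
  iterate φ zero    = identity K
  iterate φ (suc m) = φ ∘ₕ iterate φ m

  iterate-power : (φ : Hom K K) → (∀ x → Hom.⟦_⟧ φ x ≈ x ^ q) →
                  ∀ m x → Hom.⟦_⟧ (iterate φ m) x ≈ x ^ (q ℕ.^ m)
  iterate-power φ φ≈ zero    x = sym (*-identityʳ x)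
  iterate-power φ φ≈ (suc m) x = trans (φ≈ _) (trans (^-congˡ q (iterate-power φ φ≈ m x))
    (trans (^-assocʳ x (q ℕ.^ m) q) (^-congʳ x (ℕ.*-comm (q ℕ.^ m) q))))

-- An extension K of degree d of a field k with q elements, with a generator θ: every
-- element of K is a polynomial in θ over k.  The degree enters as the number q ^ d of
-- elements of K.

record SimpleExtension (k : Ring) (q d : ℕ) : Set₁ where
  field
    K              : Ring
    K-isField      : IsField K
    ι              : Hom k K
    residues       : Enumeration K (q ℕ.^ d)
  open CommutativeRing K using (Carrier; _≈_)
  open Hom ι public using () renaming (⟦_⟧ to scalar)
  field
    ι-injective    : ∀ {a b} → scalar a ≈ scalar b → CommutativeRing._≈_ k a b
    θ              : Carrier
    representative : Carrier → List (CommutativeRing.Carrier k)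
    generates      : ∀ f → f ≈ Evaluation.ev K (map scalar (representative f)) θ

  -- The value p(θ).

  value : List (CommutativeRing.Carrier k) → Carrier
  value p = Evaluation.ev K (map scalar p) θ

module Conjugates (lem : ExcludedMiddle) {k : Ring} (k-isField : IsField k)
  {r d : ℕ} (enumeration : Enumeration k (suc (suc r)))
  (extension : SimpleExtension k (suc (suc r)) d)
  where
  open SimpleExtension extension
  private
    module k = CommutativeRing k
    module E = Enumeration enumeration
  open CommutativeRing K hiding (zero)
  open Evaluation K using (ev; ev-cong)
  open SetoidReasoning setoid
  open Exp commutativeSemiring using (_^_; ^-congˡ; ^-congʳ; ^-assocʳ)
  open Sum *-commutativeMonoid using () renaming (sum to ∏; sum-cong-≋ to ∏-cong)
  open Field K-isField using (Distinct; power-fixed-bound; factorization)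

  q : ℕ
  q = suc (suc r)

  scalar-fixed : ∀ b → scalar b ^ q ≈ scalar b
  scalar-fixed b = trans (sym (Hom.^-homo ι b q))
    (Hom.cong ι (Fermat.fermat lem k-isField enumeration b))

  scalars : Fin q → Carrier
  scalars i = scalar (E.element i)

  scalars-distinct : Distinct scalars
  scalars-distinct i j e = E.injective i j (ι-injective e)

  scalars-fixed : ∀ i → scalars i ^ q ≈ scalars i
  scalars-fixed i = scalar-fixed (E.element i)

  scalars+1-fixed : ∀ i → (scalars i + 1#) ^ q ≈ scalars i + 1#
  scalars+1-fixed i = trans (^-congˡ q (sym +1-homo))
    (trans (scalar-fixed (E.element i k.+ k.1#)) +1-homo)
    where
    +1-homo : scalar (E.element i k.+ k.1#) ≈ scalars i + 1#
    +1-homo = trans (Hom.+-homo ι (E.element i) k.1#) (+-congˡ (Hom.1-homo ι))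

  open Frobenius lem K-isField scalars scalars-distinct using (frobenius; fixed-by-frobenius)

  -- The Frobenius map x ↦ x ^ q and its iterates x ↦ x ^ (q ^ m).

  φ : Hom K K
  φ = frobenius scalars-fixed scalars+1-fixed

  ψ : ℕ → Hom K K
  ψ = Iterate.iterate {K} q φ

  ψ-power : ∀ m x → Hom.⟦_⟧ (ψ m) x ≈ x ^ (q ℕ.^ m)
  ψ-power = Iterate.iterate-power {K} q φ (λ x → refl)

  ψ-scalar : ∀ m b → Hom.⟦_⟧ (ψ m) (scalar b) ≈ scalar b
  ψ-scalar zero    b = refl
  ψ-scalar (suc m) b = trans (Hom.cong φ (ψ-scalar m b)) (scalar-fixed b)

  -- f(θ) ^ (q ^ m) = f(θ ^ (q ^ m)), since the coefficients of f are fixed.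

  power-ev : ∀ m f → value f ^ (q ℕ.^ m) ≈ ev (map scalar f) (θ ^ (q ℕ.^ m))
  power-ev m f = begin
    value f ^ (q ℕ.^ m)                ≈⟨ ψ-power m _ ⟨
    Hom.⟦_⟧ (ψ m) (value f)            ≈⟨ ev-homo (ψ m) (map scalar f) θ ⟩
    ev (map (Hom.⟦_⟧ (ψ m)) (map scalar f)) (Hom.⟦_⟧ (ψ m) θ)
      ≈⟨ ev-cong (map (Hom.⟦_⟧ (ψ m)) (map scalar f)) (map scalar f) (map-fixed ι (ψ m) (ψ-scalar m) f) (ψ-power m θ) ⟩
    ev (map scalar f) (θ ^ (q ℕ.^ m))              ∎

  -- The conjugates θ ^ (q ^ i) of θ, for i < d.

  conjugate : Fin d → Carrier
  conjugate i = θ ^ (q ℕ.^ toℕ i)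

  fermat-K : ∀ f → f ^ (q ℕ.^ d) ≈ f
  fermat-K = Fermat.fermat lem K-isField residues

  -- The iterates of the Frobenius map below the d-th do not fix θ: otherwise all q ^ d
  -- elements of K would be roots of X ^ (q ^ m) - X for some m with 0 < m < d.

  orbit-length : ∀ m → 0 < m → m < d → ¬ (θ ^ (q ℕ.^ m) ≈ θ)
  orbit-length m 0<m m<d fixedθ = bound (≡.sym (ℕ.m+[n∸m]≡n 2≤qᵐ)) a
      (λ i j e → inject≤-injective qᵐ<qᵈ qᵐ<qᵈ i j (Enumeration.injective residues _ _ e))
      (λ i → all-fixed (a i))
    where
    all-fixed : ∀ f → f ^ (q ℕ.^ m) ≈ f
    all-fixed f = begin
      f ^ (q ℕ.^ m)                                        ≈⟨ ^-congˡ (q ℕ.^ m) (generates f) ⟩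
      value (representative f) ^ (q ℕ.^ m)     ≈⟨ power-ev m (representative f) ⟩
      ev (map scalar (representative f)) (θ ^ (q ℕ.^ m))
        ≈⟨ ev-cong f̂ f̂ (CommutativeRing.refl (polyRing K)) fixedθ ⟩
      value (representative f)                 ≈⟨ generates f ⟨
      f                                                    ∎
      where f̂ = map scalar (representative f)
    2≤qᵐ : 2 ≤ q ℕ.^ m
    2≤qᵐ = ℕ.≤-trans (s≤s (s≤s z≤n)) (ℕ.≤-trans (ℕ.≤-reflexive (≡.sym (ℕ.^-identityʳ q))) (ℕ.^-monoʳ-≤ q {{_}} 0<m))
    qᵐ<qᵈ : q ℕ.^ m < q ℕ.^ d
    qᵐ<qᵈ = ℕ.^-monoʳ-< q (s≤s (s≤s z≤n)) m<d
    a : Fin (suc (q ℕ.^ m)) → Carrier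
    a i = Enumeration.element residues (inject≤ i qᵐ<qᵈ)
    bound : ∀ {n j} → n ≡ suc (suc j) → (a : Fin (suc n) → Carrier) → Distinct a → ¬ (∀ i → a i ^ n ≈ a i)
    bound ≡.refl = power-fixed-bound _

  -- If θ ^ (q ^ i) = θ ^ (q ^ j) with i < j < d, then raising both sides to the power
  -- q ^ (d - j) shows that θ is fixed after d - j + i < d Frobenius steps.

  conjugate-distinct-< : ∀ i j → toℕ i < toℕ j → ¬ (conjugate i ≈ conjugate j)
  conjugate-distinct-< i j i<j e = orbit-length (d ∸ toℕ j ℕ.+ toℕ i)
    (ℕ.≤-trans (ℕ.m<n⇒0<n∸m (toℕ<n j)) (ℕ.m≤m+n _ _))
    (ℕ.<-≤-trans (ℕ.+-monoʳ-< (d ∸ toℕ j) i<j) (ℕ.≤-reflexive (ℕ.m∸n+n≡m (ℕ.<⇒≤ (toℕ<n j)))))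
    (begin
      θ ^ (q ℕ.^ (c ℕ.+ toℕ i))         ≈⟨ merge (toℕ i) ⟨
      conjugate i ^ (q ℕ.^ c)           ≈⟨ ^-congˡ (q ℕ.^ c) e ⟩
      conjugate j ^ (q ℕ.^ c)           ≈⟨ merge (toℕ j) ⟩
      θ ^ (q ℕ.^ (c ℕ.+ toℕ j))         ≈⟨ ^-congʳ θ (≡.cong (q ℕ.^_) (ℕ.m∸n+n≡m (ℕ.<⇒≤ (toℕ<n j)))) ⟩
      θ ^ (q ℕ.^ d)                     ≈⟨ fermat-K θ ⟩
      θ                                 ∎)
    where
    c = d ∸ toℕ j
    merge : ∀ i → (θ ^ (q ℕ.^ i)) ^ (q ℕ.^ c) ≈ θ ^ (q ℕ.^ (c ℕ.+ i))
    merge i = trans (^-assocʳ θ (q ℕ.^ i) (q ℕ.^ c)) (^-congʳ θ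
      (≡.trans (≡.sym (ℕ.^-distribˡ-+-* q i c)) (≡.cong (q ℕ.^_) (ℕ.+-comm i c))))

  conjugate-distinct : Distinct conjugate
  conjugate-distinct i j e with ℕ.<-cmp (toℕ i) (toℕ j)
  ... | tri< i<j _ _ = contradiction e (conjugate-distinct-< i j i<j)
  ... | tri≈ _ i≡j _ = toℕ-injective i≡j
  ... | tri> _ _ j<i = contradiction (sym e) (conjugate-distinct-< j i j<i)

  -- The norm from K to k, as the product f * f ^ q * ... * f ^ (q ^ (d - 1)).

  norm : Carrier → Carrier
  norm f = f ^ geometric q d

  norm-∏ : ∀ f → norm (value f) ≈ ∏ (λ i → ev (map scalar f) (conjugate i))
  norm-∏ f = trans (GeometricPower.^-geometric K q d _) (∏-cong {d} (λ i → power-ev (toℕ i) f))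

  -- Norms lie in k: as (1 + q + ... + q ^ (d - 1)) * (q - 1) = q ^ d - 1, the norm of a
  -- unit is fixed by the Frobenius map.

  norm-scalar : ∀ f → ¬ (f ≈ 0#) → ∃[ c ] scalar c ≈ norm f
  norm-scalar f f≉0 =
    let (i , e) = fixed-by-frobenius scalars-fixed scalars+1-fixed ≡.refl (norm f) norm-fixed
    in E.element i , e
    where
    units : Enumeration K (suc (geometric q d ℕ.* suc r))
    units = ≡.subst (Enumeration K) (≡.sym (geometric-sum (suc r) d)) residues
    norm-fixed : norm f ^ q ≈ norm f
    norm-fixed = begin
      norm f * norm f ^ suc r                      ≈⟨ *-congˡ (^-assocʳ f (geometric q d) (suc r)) ⟩
      norm f * f ^ (geometric q d ℕ.* suc r)
        ≈⟨ *-congˡ (Fermat.unit-power lem K-isField units f f≉0) ⟩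
      norm f * 1#                                  ≈⟨ *-identityʳ _ ⟩
      norm f                                       ∎

  module _ {P : List k.Carrier} (monic : Evaluation.IsMonic k d P) (Pθ≈0 : value P ≈ 0#) where

    conjugate-root : ∀ i → ev (map scalar P) (conjugate i) ≈ 0#
    conjugate-root i = begin
      ev (map scalar P) (conjugate i)                  ≈⟨ power-ev (toℕ i) P ⟨
      value P ^ (q ℕ.^ toℕ i)              ≈⟨ ψ-power (toℕ i) _ ⟨
      Hom.⟦_⟧ (ψ (toℕ i)) (value P)        ≈⟨ Hom.cong (ψ (toℕ i)) Pθ≈0 ⟩
      Hom.⟦_⟧ (ψ (toℕ i)) 0#                           ≈⟨ Hom.0-homo (ψ (toℕ i)) ⟩
      0#                                               ∎

    module _ {A : Ring} (f : Hom K A) where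
      private module A = CommutativeRing A

      -- P splits into linear factors in every ring A with a homomorphism from K.

      splitting : ∀ x → Evaluation.ev A (map (Hom.⟦_⟧ f) (map scalar P)) x A.≈
                  Sum.sum A.*-commutativeMonoid (λ i → x A.- Hom.⟦_⟧ f (conjugate i))
      splitting = factorization f (monic-map ι monic) conjugate conjugate-distinct conjugate-root

-- Reciprocity of norms

negate-homo : ∀ {R S} (f : Hom R S) x → let open CommutativeRing in
              _≈_ S (Hom.⟦_⟧ f (-_ R x)) (-_ S (Hom.⟦_⟧ f x))
negate-homo {R} {S} f x = +-inverseˡ-unique _ _
    (trans (sym (+-homo (R.- x) x)) (trans (cong (R.-‿inverseˡ x)) 0-homo))
  where
  open Hom f
  module R = CommutativeRing R
  open CommutativeRing S
  open RingProperties ring using (+-inverseˡ-unique)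

∏-homo : ∀ {R S} (f : Hom R S) {n} (t : Fin n → CommutativeRing.Carrier R) →
         CommutativeRing._≈_ S (Hom.⟦_⟧ f (Sum.sum (CommutativeRing.*-commutativeMonoid R) t))
           (Sum.sum (CommutativeRing.*-commutativeMonoid S) (λ i → Hom.⟦_⟧ f (t i)))
∏-homo         f {zero}  t = Hom.1-homo f
∏-homo {R} {S} f {suc n} t = trans (Hom.*-homo f _ _) (*-congˡ (∏-homo f (t ∘ suc)))
  where open CommutativeRing S

module Resultant (A : Ring) where
  open CommutativeRing A hiding (zero)
  open RingProperties ring using (-1*x≈-x; -‿+-comm; -‿involutive)
  open SetoidReasoning setoid
  open Exp commutativeSemiring using (_^_)
  open Sum *-commutativeMonoid renaming (sum to ∏; sum-cong-≋ to ∏-cong; ∑-comm to ∏-comm;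
    ∑-distrib-+ to ∏-distrib-*; sum-replicate to ∏-replicate)

  ∏-scale : ∀ n c (t : Fin n → Carrier) → ∏ (λ i → c * t i) ≈ c ^ n * ∏ t
  ∏-scale n c t = trans (∏-distrib-* (λ _ → c) t) (*-congʳ (∏-replicate n))

  difference-swap : ∀ x y → x - y ≈ - 1# * (y - x)
  difference-swap x y = begin
    x - y              ≈⟨ +-comm x (- y) ⟩
    - y + x            ≈⟨ +-congˡ (-‿involutive x) ⟨
    - y + - (- x)      ≈⟨ -‿+-comm y (- x) ⟩
    - (y - x)          ≈⟨ -1*x≈-x (y - x) ⟨
    - 1# * (y - x)     ∎

  ∏-differences : ∀ {m n} (a : Fin m → Carrier) (b : Fin n → Carrier) →
    ∏ (λ i → ∏ (λ j → a i - b j)) ≈ ((- 1#) ^ n) ^ m * ∏ (λ j → ∏ (λ i → b j - a i))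
  ∏-differences {m} {n} a b = begin
    ∏ (λ i → ∏ (λ j → a i - b j))
      ≈⟨ ∏-cong {m} (λ i → ∏-cong {n} (λ j → difference-swap (a i) (b j))) ⟩
    ∏ (λ i → ∏ (λ j → - 1# * (b j - a i)))
      ≈⟨ ∏-cong {m} (λ i → ∏-scale n (- 1#) (λ j → b j - a i)) ⟩
    ∏ (λ i → (- 1#) ^ n * ∏ (λ j → b j - a i))
      ≈⟨ ∏-scale m ((- 1#) ^ n) (λ i → ∏ (λ j → b j - a i)) ⟩
    ((- 1#) ^ n) ^ m * ∏ (λ i → ∏ (λ j → b j - a i)) ≈⟨ *-congˡ (∏-comm (λ i j → b j - a i)) ⟩
    ((- 1#) ^ n) ^ m * ∏ (λ j → ∏ (λ i → b j - a i)) ∎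

-- Two simple extensions E, F of k with generators θ and η, of degrees d and ℓ, and
-- homomorphisms f, g from them to a ring A that agree on k.

module NormImage (lem : ExcludedMiddle) {k : Ring} (k-isField : IsField k)
  {r d ℓ : ℕ} (enumeration : Enumeration k (suc (suc r)))
  (E : SimpleExtension k (suc (suc r)) d) (F : SimpleExtension k (suc (suc r)) ℓ)
  {A : Ring} (f : Hom (SimpleExtension.K E) A) (g : Hom (SimpleExtension.K F) A)
  where
  private
    module E = SimpleExtension E
    module F = SimpleExtension F
    module CE = Conjugates lem k-isField enumeration E
    module CF = Conjugates lem k-isField enumeration F
    module EK = CommutativeRing E.K
    module FK = CommutativeRing F.K
  open CommutativeRing A hiding (zero)
  open Hom f using () renaming (⟦_⟧ to ⟦_⟧E)
  open Hom g using () renaming (⟦_⟧ to ⟦_⟧F)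
  open Sum *-commutativeMonoid using () renaming (sum to ∏; sum-cong-≋ to ∏-cong)
  open Evaluation A using (ev; ev-cong)
  open SetoidReasoning setoid

  -- If Q(η) = 0, then the norm of Q(θ) becomes in A the product of all differences of
  -- a conjugate of θ and a conjugate of η.

  norm-image : (∀ b → ⟦ E.scalar b ⟧E ≈ ⟦ F.scalar b ⟧F) →
    ∀ {Q} → Evaluation.IsMonic k ℓ Q → F.value Q FK.≈ FK.0# →
    ⟦ CE.norm (E.value Q) ⟧E ≈ ∏ (λ i → ∏ (λ j → ⟦ CE.conjugate i ⟧E - ⟦ CF.conjugate j ⟧F))
  norm-image agree {Q} monic root = begin
    ⟦ CE.norm (E.value Q) ⟧E
      ≈⟨ Hom.cong f (CE.norm-∏ Q) ⟩
    ⟦ Sum.sum EK.*-commutativeMonoid (λ i → Evaluation.ev E.K (map E.scalar Q) (CE.conjugate i)) ⟧E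
      ≈⟨ ∏-homo f (λ i → Evaluation.ev E.K (map E.scalar Q) (CE.conjugate i)) ⟩
    ∏ (λ i → ⟦ Evaluation.ev E.K (map E.scalar Q) (CE.conjugate i) ⟧E)
      ≈⟨ ∏-cong {d} (λ i → ev-homo f (map E.scalar Q) (CE.conjugate i)) ⟩
    ∏ (λ i → ev (map ⟦_⟧E (map E.scalar Q)) ⟦ CE.conjugate i ⟧E)
      ≈⟨ ∏-cong {d} (λ i → ev-cong (map ⟦_⟧E (map E.scalar Q)) (map ⟦_⟧F (map F.scalar Q)) (map-agree Q) refl) ⟩
    ∏ (λ i → ev (map ⟦_⟧F (map F.scalar Q)) ⟦ CE.conjugate i ⟧E)
      ≈⟨ ∏-cong {d} (λ i → CF.splitting monic root g ⟦ CE.conjugate i ⟧E) ⟩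
    ∏ (λ i → ∏ (λ j → ⟦ CE.conjugate i ⟧E - ⟦ CF.conjugate j ⟧F)) ∎
    where
    map-agree : ∀ Q → PolynomialRing._≋_ A (map ⟦_⟧E (map E.scalar Q)) (map ⟦_⟧F (map F.scalar Q))
    map-agree []      = CommutativeRing.refl (polyRing A)
    map-agree (b ∷ Q) = PolynomialRing.∷-cong A (agree b) (map-agree Q)

module NormReciprocity (lem : ExcludedMiddle) {k : Ring} (k-isField : IsField k)
  {r d ℓ : ℕ} (enumeration : Enumeration k (suc (suc r)))
  (E : SimpleExtension k (suc (suc r)) d) (F : SimpleExtension k (suc (suc r)) ℓ)
  {A : Ring} (f : Hom (SimpleExtension.K E) A) (g : Hom (SimpleExtension.K F) A)
  where
  private
    module E = SimpleExtension E
    module F = SimpleExtension F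
    module CE = Conjugates lem k-isField enumeration E
    module CF = Conjugates lem k-isField enumeration F
    module k = CommutativeRing k
    module EK = CommutativeRing E.K
    module FK = CommutativeRing F.K
  open CommutativeRing A hiding (zero)
  open Hom f using () renaming (⟦_⟧ to ⟦_⟧E)
  open Hom g using () renaming (⟦_⟧ to ⟦_⟧F)
  open Exp k.commutativeSemiring using () renaming (_^_ to _^k_)
  open Exp commutativeSemiring using (_^_; ^-congˡ)
  open Resultant A using (∏-differences)
  open SetoidReasoning setoid

  -- Here P(θ) = 0 and Q(η) = 0, and x, y in k are the norms of Q(θ) and P(η).

  norm-reciprocity :
    (∀ b → ⟦ E.scalar b ⟧E ≈ ⟦ F.scalar b ⟧F) →
    (∀ {a b} → ⟦ F.scalar a ⟧F ≈ ⟦ F.scalar b ⟧F → a k.≈ b) →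
    ∀ {P Q} → Evaluation.IsMonic k d P → E.value P EK.≈ EK.0# →
    Evaluation.IsMonic k ℓ Q → F.value Q FK.≈ FK.0# →
    ∀ {x y} → E.scalar x EK.≈ CE.norm (E.value Q) → F.scalar y FK.≈ CF.norm (F.value P) →
    x k.≈ ((k.- k.1#) ^k ℓ) ^k d k.* y
  norm-reciprocity agree injective {P} {Q} monicP rootP monicQ rootQ {x} {y} x≈norm y≈norm = injective (begin
    ⟦ F.scalar x ⟧F                                ≈⟨ agree x ⟨
    ⟦ E.scalar x ⟧E                                ≈⟨ Hom.cong f x≈norm ⟩
    ⟦ CE.norm (E.value Q) ⟧E
      ≈⟨ NormImage.norm-image lem k-isField enumeration E F f g agree monicQ rootQ ⟩
    _
      ≈⟨ ∏-differences (λ i → ⟦ CE.conjugate i ⟧E) (λ j → ⟦ CF.conjugate j ⟧F) ⟩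
    ((- 1#) ^ ℓ) ^ d * _
      ≈⟨ *-congˡ (NormImage.norm-image lem k-isField enumeration F E g f (λ b → sym (agree b)) monicP rootP) ⟨
    ((- 1#) ^ ℓ) ^ d * ⟦ CF.norm (F.value P) ⟧F    ≈⟨ *-congˡ (Hom.cong g y≈norm) ⟨
    ((- 1#) ^ ℓ) ^ d * Hom.⟦_⟧ h y                 ≈⟨ *-congʳ (^-congˡ d (^-congˡ ℓ h-1)) ⟨
    (Hom.⟦_⟧ h (k.- k.1#) ^ ℓ) ^ d * Hom.⟦_⟧ h y   ≈⟨ *-congʳ (^-congˡ d (Hom.^-homo h _ ℓ)) ⟨
    Hom.⟦_⟧ h ((k.- k.1#) ^k ℓ) ^ d * Hom.⟦_⟧ h y  ≈⟨ *-congʳ (Hom.^-homo h _ d) ⟨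
    Hom.⟦_⟧ h (((k.- k.1#) ^k ℓ) ^k d) * Hom.⟦_⟧ h y ≈⟨ Hom.*-homo h _ y ⟨
    Hom.⟦_⟧ h (((k.- k.1#) ^k ℓ) ^k d k.* y)       ∎)
    where
    h : Hom k A
    h = g ∘ₕ F.ι
    h-1 : Hom.⟦_⟧ h (k.- k.1#) ≈ - 1#
    h-1 = trans (negate-homo h k.1#) (-‿cong (Hom.1-homo h))

-- Reciprocity over a finite field

residueExtension : ExcludedMiddle → ∀ {k} → IsField k → ∀ {d-1 P} →
  Evaluation.IsMonic k (suc d-1) P → SplitsTrivially k P →
  ∀ {q} → Enumeration k q → SimpleExtension k q (suc d-1)
residueExtension lem {k} k-isField {d-1} {P} monic splits {q} enumeration = record
  { K              = K
  ; K-isField      = K-isField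
  ; ι              = inclusion
  ; residues       = residues enumeration
  ; ι-injective    = inclusion-injective
  ; θ              = Evaluation.X k
  ; representative = λ f → f
  ; generates      = ev-indeterminate
  }
  where open ResidueField lem k-isField monic splits

powers-nonzero : ∀ {K} → IsField K → let open CommutativeRing K in
  ∀ n x → ¬ (x ≈ 0#) → ¬ (Exp._^_ commutativeSemiring x n ≈ 0#)
powers-nonzero K-isField zero    x x≉0 = IsField.1≉0 K-isField
powers-nonzero K-isField (suc n) x x≉0 e =
  powers-nonzero K-isField n x x≉0 (Field.*-cancel-0 K-isField x _ x≉0 e)

-- x is a unit of k to which α ^ E is congruent modulo P.

IsResidueOf : (k : Ring) (P : List (CommutativeRing.Carrier k)) (E : ℕ)
              (α : List (CommutativeRing.Carrier k)) → CommutativeRing.Carrier k → Set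
IsResidueOf k P E α x = IsUnit k x × ∃[ c ] c * P ≈ α ^ E - (x ∷ [])
  where
  open CommutativeRing (polyRing k)
  open Exp commutativeSemiring using (_^_)

module MonicResidue (k : Ring) {d-1 : ℕ} {P : List (CommutativeRing.Carrier k)}
                    (monic : Evaluation.IsMonic k (suc d-1) P) where
  private
    module k = CommutativeRing k
    module k[t] = CommutativeRing (polyRing k)
  open MonicQuotient k monic
  open CommutativeRing R[t]/P
  open Exp commutativeSemiring using (_^_; ^-congˡ; ^-assocʳ)
  open Exp k.commutativeSemiring using () renaming (_^_ to _^k_)
  open Exp k[t].commutativeSemiring using () renaming (_^_ to _^k[t]_)
  open SetoidReasoning setoid
  open QuotientRing (polyRing k) P using (∼⇒∣; ∣⇒∼)

  residue-unique : ∀ {E α x y} → IsResidueOf k P E α x → IsResidueOf k P E α y → x k.≈ y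
  residue-unique {E} {α} {x} {y} (_ , c , e) (_ , c′ , e′) = inclusion-injective
    (trans (sym (∣⇒∼ {α ^k[t] E} {x ∷ []} c e)) (∣⇒∼ {α ^k[t] E} {y ∷ []} c′ e′))

  residue-power : ∀ {α x} g → x ∷ [] ≈ α ^ g → IsUnit k x → ∀ e → IsResidueOf k P (g ℕ.* e) α (x ^k e)
  residue-power {α} {x} g x≈αᵍ (u , ux≈1) e = (u ^k e , unit) , ∼⇒∣ (begin
    α ^k[t] (g ℕ.* e)     ≈⟨ Hom.^-homo (quotientMap (polyRing k) P) α (g ℕ.* e) ⟩
    α ^ (g ℕ.* e)         ≈⟨ ^-assocʳ α g e ⟨
    (α ^ g) ^ e           ≈⟨ ^-congˡ e x≈αᵍ ⟨
    (x ∷ []) ^ e          ≈⟨ Hom.^-homo inclusion x e ⟨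
    (x ^k e) ∷ []         ∎)
    where
    1^n : ∀ n → k.1# ^k n k.≈ k.1#
    1^n zero    = k.refl
    1^n (suc n) = k.trans (k.*-identityˡ _) (1^n n)
    unit : u ^k e k.* x ^k e k.≈ k.1#
    unit = k.trans (k.sym (Exp.^-distrib-* k.commutativeSemiring u x e))
      (k.trans (Exp.^-congˡ k.commutativeSemiring e ux≈1) (1^n e))

module FiniteReciprocity (lem : ExcludedMiddle) {k : Ring} (k-isField : IsField k)
  {r : ℕ} (enumeration : Enumeration k (suc (suc r))) where
  open CommutativeRing k hiding (zero)
  open IsField k-isField
  open Exp commutativeSemiring using (_^_; ^-congˡ; ^-distrib-*; ^-assocʳ)
  private module k[t] = CommutativeRing (polyRing k)

  q : ℕ
  q = suc (suc r)

  module Norm {d-1 P} (monic : Evaluation.IsMonic k (suc d-1) P) (splits : SplitsTrivially k P) where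
    open MonicQuotient k monic using (inclusion; ev-indeterminate)
    open QuotientRing (polyRing k) P using (m∼0)

    extension : SimpleExtension k q (suc d-1)
    extension = residueExtension lem k-isField monic splits enumeration

    open SimpleExtension extension using (K; K-isField; scalar; value)
    module K = CommutativeRing K
    open Conjugates lem k-isField enumeration extension using (norm; norm-scalar)

    value-P : value P K.≈ K.0#
    value-P = K.trans (K.sym (ev-indeterminate P)) m∼0

    norm-unit : ∀ α → ¬ (∃[ c ] c k[t].* P k[t].≈ α) → ∃[ x ] scalar x K.≈ norm α × IsUnit k x
    norm-unit α P∤α =
      let (x , e)    = norm-scalar α α≉0
          (u , xu≈1) = inverse x λ x≈0 → powers-nonzero K-isField (geometric q (suc d-1)) α α≉0
            (K.trans (K.sym e) (K.trans (Hom.cong inclusion x≈0) (Hom.0-homo inclusion)))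
      in x , e , u , trans (*-comm u x) xu≈1
      where
      α≉0 : ¬ (α K.≈ K.0#)
      α≉0 e = let (c , cP≈α-0) = QuotientRing.∼⇒∣ (polyRing k) P e in
        P∤α (c , k[t].trans cP≈α-0 (k[t].+-identityʳ α))

  module _ {d-1 ℓ-1 P Q}
    (monicP : Evaluation.IsMonic k (suc d-1) P) (splitsP : SplitsTrivially k P)
    (monicQ : Evaluation.IsMonic k (suc ℓ-1) Q) (splitsQ : SplitsTrivially k Q)
    (P∤Q : ¬ (∃[ c ] c k[t].* P k[t].≈ Q)) (Q∤P : ¬ (∃[ c ] c k[t].* Q k[t].≈ P)) where
    private
      module NP = Norm monicP splitsP
      module NQ = Norm monicQ splitsQ
      module EP = SimpleExtension NP.extension
      module EQ = SimpleExtension NQ.extension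
      module MQ = MonicQuotient k monicQ
      -- The tensor product of the two residue fields, as L[t]/P for L = k[u]/Q.
      module A = MonicQuotient EQ.K (monic-map MQ.inclusion monicP)

    f : Hom EP.K A.R[t]/P
    f = quotientHom (mapHom MQ.inclusion) P

    -- x and y are the norms of Q modulo P and of P modulo Q.

    scalar-norms : ∃₂ λ x y →
      (x ∷ [] NP.K.≈ Exp._^_ NP.K.commutativeSemiring Q (geometric q (suc d-1))) × IsUnit k x ×
      (y ∷ [] NQ.K.≈ Exp._^_ NQ.K.commutativeSemiring P (geometric q (suc ℓ-1))) × IsUnit k y ×
      x ≈ ((- 1#) ^ suc ℓ-1) ^ suc d-1 * y
    scalar-norms =
      let (x , x≈norm , x-unit) = NP.norm-unit Q P∤Q
          (y , y≈norm , y-unit) = NQ.norm-unit P Q∤P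
      in x , y , x≈norm , x-unit , y≈norm , y-unit ,
         NormReciprocity.norm-reciprocity lem k-isField enumeration NP.extension NQ.extension f A.inclusion
           (λ b → CommutativeRing.refl A.R[t]/P)
           (λ e → MQ.inclusion-injective (A.inclusion-injective e))
           monicP NP.value-P monicQ NQ.value-P
           (NP.K.trans x≈norm (Exp.^-congˡ NP.K.commutativeSemiring (geometric q (suc d-1))
             (MonicQuotient.ev-indeterminate k monicP Q)))
           (NQ.K.trans y≈norm (Exp.^-congˡ NQ.K.commutativeSemiring (geometric q (suc ℓ-1))
             (MQ.ev-indeterminate P)))

    finite-reciprocity : ∀ e → ∃₂ λ x y →
      IsResidueOf k P (geometric q (suc d-1) ℕ.* e) Q x ×
      IsResidueOf k Q (geometric q (suc ℓ-1) ℕ.* e) P y ×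
      x ≈ (- 1#) ^ (suc ℓ-1 ℕ.* suc d-1 ℕ.* e) * y
    finite-reciprocity e =
      let (x , y , x≈ , x-unit , y≈ , y-unit , x≈±y) = scalar-norms
      in x ^ e , y ^ e ,
         MonicResidue.residue-power k monicP (geometric q (suc d-1)) x≈ x-unit e ,
         MonicResidue.residue-power k monicQ (geometric q (suc ℓ-1)) y≈ y-unit e ,
         trans (^-congˡ e x≈±y) (trans (^-distrib-* _ y e) (*-congʳ
           (trans (^-congˡ e (^-assocʳ (- 1#) (suc ℓ-1) (suc d-1)))
             (^-assocʳ (- 1#) (suc ℓ-1 ℕ.* suc d-1) e))))

-- Ultraproducts of rings

module Ultrafilter {S : Set} {𝒟 : Pred (Pred S 0ℓ) 0ℓ} (U : IsNonprincipalUltrafilter 𝒟) where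
  open IsNonprincipalUltrafilter U

  excludedMiddle : ExcludedMiddle
  excludedMiddle A with ultra (λ _ → A)
  ... | inj₁ A∈𝒟  = yes (proj₂ (inhabited A∈𝒟))
  ... | inj₂ ∁A∈𝒟 = no (proj₂ (inhabited ∁A∈𝒟))

  impossible : ∀ {A} → A ∈ 𝒟 → ¬ (∀ {s} → ¬ A s)
  impossible A∈𝒟 ¬A = ¬A (proj₂ (inhabited A∈𝒟))

  always : ∀ {A} → (∀ s → A s) → A ∈ 𝒟
  always {A} a with ultra A
  ... | inj₁ A∈𝒟  = A∈𝒟
  ... | inj₂ ∁A∈𝒟 = contradiction (λ {s} ¬A → ¬A (a s)) (impossible ∁A∈𝒟)

  both : ∀ {A B C : Pred S 0ℓ} → A ∈ 𝒟 → B ∈ 𝒟 → (∀ {s} → A s → B s → C s) → C ∈ 𝒟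
  both A∈𝒟 B∈𝒟 f = upward (λ (a , b) → f a b) (intersection A∈𝒟 B∈𝒟)

  complement : ∀ {A} → ¬ (A ∈ 𝒟) → ∁ A ∈ 𝒟
  complement {A} A∉𝒟 with ultra A
  ... | inj₁ A∈𝒟  = contradiction A∈𝒟 A∉𝒟
  ... | inj₂ ∁A∈𝒟 = ∁A∈𝒟

  -- Witnesses that exist at almost all s form a family, completed by default values.

  choose : ∀ {B : S → Set} {C : ∀ s → B s → Set} → (∀ s → B s) →
           (λ s → Σ[ b ∈ B s ] C s b) ∈ 𝒟 → Σ[ b ∈ (∀ s → B s) ] (λ s → C s (b s)) ∈ 𝒟
  choose {B} {C} default Σ∈𝒟 = (λ s → pick s (excludedMiddle _)) , upward (λ {s} → picked (excludedMiddle _)) Σ∈𝒟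
    where
    pick : ∀ s → Dec (Σ[ b ∈ B s ] C s b) → B s
    pick s (yes (b , _)) = b
    pick s (no _)        = default s
    picked : ∀ {s} (d : Dec (Σ[ b ∈ B s ] C s b)) → Σ[ b ∈ B s ] C s b → C s (pick s d)
    picked (yes (_ , c)) _ = c
    picked (no ∄)        e = contradiction e ∄

module Ultraproduct {S : Set} {𝒟 : Pred (Pred S 0ℓ) 0ℓ} (U : IsNonprincipalUltrafilter 𝒟)
                    (R : S → Ring) where
  open IsNonprincipalUltrafilter U
  open Ultrafilter U
  private
    module R (s : S) = CommutativeRing (R s)
    module R[t] (s : S) = PolynomialRing (R s)

  raw : RawRing 0ℓ 0ℓ
  raw = ultraproduct 𝒟 (λ s → CommutativeRing.rawRing (R s))

  open RawRing raw

  abstract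
    ultraproduct-isCommutativeRing : IsCommutativeRing _≈_ _+_ _*_ -_ 0# 1#
    ultraproduct-isCommutativeRing = record
      { isRing = record
        { +-isAbelianGroup = record
          { isGroup = record
            { isMonoid = record
              { isSemigroup = record
                { isMagma = record
                  { isEquivalence = record
                    { refl  = always λ s → R.refl s
                    ; sym   = upward λ {s} → R.sym s
                    ; trans = λ e f → both e f λ {s} → R.trans s
                    }
                  ; ∙-cong = λ e f → both e f λ {s} → R.+-cong s
                  }
                ; assoc = λ x y z → always λ s → R.+-assoc s (x s) (y s) (z s)
                }
              ; identity = (λ x → always λ s → R.+-identityˡ s (x s))
                         , (λ x → always λ s → R.+-identityʳ s (x s))
              }
            ; inverse = (λ x → always λ s → R.-‿inverseˡ s (x s))
                      , (λ x → always λ s → R.-‿inverseʳ s (x s))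
            ; ⁻¹-cong = upward λ {s} → R.-‿cong s
            }
          ; comm = λ x y → always λ s → R.+-comm s (x s) (y s)
          }
        ; *-cong = λ e f → both e f λ {s} → R.*-cong s
        ; *-assoc = λ x y z → always λ s → R.*-assoc s (x s) (y s) (z s)
        ; *-identity = (λ x → always λ s → R.*-identityˡ s (x s))
                     , (λ x → always λ s → R.*-identityʳ s (x s))
        ; distrib = (λ x y z → always λ s → R.distribˡ s (x s) (y s) (z s))
                  , (λ x y z → always λ s → R.distribʳ s (x s) (y s) (z s))
        }
      ; *-comm = λ x y → always λ s → R.*-comm s (x s) (y s)
      }

  ultraproductRing : Ring
  ultraproductRing = record { isCommutativeRing = ultraproduct-isCommutativeRing }

  open PolynomialRing ultraproductRing

  -- The component at s of a polynomial over the ultraproduct.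

  component : List Carrier → ∀ s → List (R.Carrier s)
  component p s = map (λ a → a s) p

  coeff-component : ∀ p i s → R[t].coeff s (component p s) i ≡ coeff p i s
  coeff-component []      i       s = ≡.refl
  coeff-component (a ∷ p) zero    s = ≡.refl
  coeff-component (a ∷ p) (suc i) s = coeff-component p i s

  -- Equality of polynomials is equality at almost all components; it involves only
  -- finitely many coefficients.

  component-≋⁻ : ∀ p q → (λ s → R[t]._≋_ s (component p s) (component q s)) ∈ 𝒟 → p ≋ q
  component-≋⁻ p q e = coeffwise λ i → upward
    (λ {s} e → ≡.subst₂ (R._≈_ s) (coeff-component p i s) (coeff-component q i s) (R[t].at e i)) e

  component-≋ : ∀ p q → p ≋ q → (λ s → R[t]._≋_ s (component p s) (component q s)) ∈ 𝒟
  component-≋ []      []      e = always λ s → CommutativeRing.refl (polyRing (R s))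
  component-≋ []      (b ∷ q) e = both (at e 0) (component-≋ [] q (coeffwise (at e ∘ suc)))
    λ {s} e f → R[t].coeffwise {s} λ { zero → e ; (suc i) → R[t]._≋_.at f i }
  component-≋ (a ∷ p) []      e = both (at e 0) (component-≋ p [] (coeffwise (at e ∘ suc)))
    λ {s} e f → R[t].coeffwise {s} λ { zero → e ; (suc i) → R[t]._≋_.at f i }
  component-≋ (a ∷ p) (b ∷ q) e = both (at e 0) (component-≋ p q (coeffwise (at e ∘ suc)))
    λ {s} → R[t].∷-cong s

  component-add : ∀ p q s → component (add p q) s ≡ R[t].add s (component p s) (component q s)
  component-add []      q       s = ≡.refl
  component-add (a ∷ p) []      s = ≡.refl
  component-add (a ∷ p) (b ∷ q) s = ≡.cong (_ ∷_) (component-add p q s)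

  component-scale : ∀ a p s → component (scale a p) s ≡ R[t].scale s (a s) (component p s)
  component-scale a []      s = ≡.refl
  component-scale a (b ∷ p) s = ≡.cong (_ ∷_) (component-scale a p s)

  component-mul : ∀ p q s → component (mul p q) s ≡ R[t].mul s (component p s) (component q s)
  component-mul []      q s = ≡.refl
  component-mul (a ∷ p) q s = ≡.trans (component-add (scale a q) (0# ∷ mul p q) s)
    (≡.cong₂ (R[t].add s) (component-scale a q s) (≡.cong (R.0# s ∷_) (component-mul p q s)))

  -- A family of polynomials with at most n coefficients each, as one polynomial over
  -- the ultraproduct.

  assemble : ℕ → (∀ s → List (R.Carrier s)) → List Carrier
  assemble n p = tabulate {n = n} (λ i s → R[t].coeff s (p s) (toℕ i))

  component-assemble : ∀ n p s → length (p s) ≤ n → R[t]._≋_ s (p s) (component (assemble n p) s)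
  component-assemble n p s l = ≡.subst (R[t]._≋_ s (p s))
    (≡.sym (map-tabulate {n = n} (λ i s → R[t].coeff s (p s) (toℕ i)) (λ a → a s))) (≋-tabulate (R s) n (p s) l)

  component-monic : ∀ {d p} → Evaluation.IsMonic ultraproductRing d p →
                    (λ s → Evaluation.IsMonic (R s) d (component p s)) ∈ 𝒟
  component-monic (Evaluation.leading e) = upward (λ e → Evaluation.leading e) e
  component-monic (a Evaluation.∷ M)     = upward (λ M → _ Evaluation.∷ M) (component-monic M)

  -- If P splits at almost all components into two non-units with boundedly many
  -- coefficients, then these factors assemble to a splitting over the ultraproduct.

  component-splits : ∀ {P} →
    (∀ f g → P ≋ mul f g → IsUnit (polyRing ultraproductRing) f ⊎ IsUnit (polyRing ultraproductRing) g) →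
    (λ s → SplitsTrivially (R s) (component P s)) ∈ 𝒟
  component-splits {P} irreducible with ultra (λ s → SplitsTrivially (R s) (component P s))
  ... | inj₁ splits = splits
  ... | inj₂ ¬splits = contradiction (irreducible f g P≋fg) λ
      { (inj₁ unit) → impossible (both factors (component-unit f unit) λ {s} (l , _ , _ , ¬unit , _) u →
          ¬unit (unit-resp s (component-assemble N (proj₁ ∘ fg) s l) u)) λ {s} ()
      ; (inj₂ unit) → impossible (both factors (component-unit g unit) λ {s} (_ , l , _ , _ , ¬unit) u →
          ¬unit (unit-resp s (component-assemble N (proj₂ ∘ fg) s l) u)) λ {s} ()
      }
    where
    N = length P
    IsSplitting : ∀ s → List (R.Carrier s) × List (R.Carrier s) → Set
    IsSplitting s (f , g) = length f ≤ N × length g ≤ N × R[t]._≋_ s (component P s) (R[t].mul s f g) ×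
      ¬ IsUnit (polyRing (R s)) f × ¬ IsUnit (polyRing (R s)) g
    splitting : ∀ s → ¬ SplitsTrivially (R s) (component P s) → ∃[ fg ] IsSplitting s fg
    splitting s ¬splits with excludedMiddle (∃[ fg ] IsSplitting s fg)
    ... | yes fg = fg
    ... | no  ∄  = contradiction
      (λ f g l l′ e → decide f g (≡.subst (length f ≤_) (length-map _ P) l)
        (≡.subst (length g ≤_) (length-map _ P) l′) e (excludedMiddle _) (excludedMiddle _)) ¬splits
      where
      decide : ∀ f g → length f ≤ N → length g ≤ N → R[t]._≋_ s (component P s) (R[t].mul s f g) →
        Dec (IsUnit (polyRing (R s)) f) → Dec (IsUnit (polyRing (R s)) g) →
        IsUnit (polyRing (R s)) f ⊎ IsUnit (polyRing (R s)) g
      decide f g l l′ e (yes u) _       = inj₁ u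
      decide f g l l′ e (no _)  (yes u) = inj₂ u
      decide f g l l′ e (no ¬u) (no ¬v) = contradiction ((f , g) , l , l′ , e , ¬u , ¬v) ∄
    chosen = choose (λ s → [] , []) (upward (λ {s} → splitting s) ¬splits)
    fg = proj₁ chosen
    factors = proj₂ chosen
    f = assemble N (proj₁ ∘ fg)
    g = assemble N (proj₂ ∘ fg)
    P≋fg : P ≋ mul f g
    P≋fg = component-≋⁻ P (mul f g) (upward (λ {s} (l , l′ , e , _) →
      ≡.subst (R[t]._≋_ s (component P s)) (≡.sym (component-mul f g s))
        (CommutativeRing.trans (polyRing (R s)) e (R[t].mul-cong s
          (component-assemble N (proj₁ ∘ fg) s l) (component-assemble N (proj₂ ∘ fg) s l′)))) factors)
    component-unit : ∀ f → IsUnit (polyRing ultraproductRing) f →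
                     (λ s → IsUnit (polyRing (R s)) (component f s)) ∈ 𝒟
    component-unit f (h , e) = upward (λ {s} e → component h s ,
      ≡.subst (λ p → R[t]._≋_ s p (R.1# s ∷ [])) (component-mul h f s) e) (component-≋ (mul h f) (1# ∷ []) e)
    unit-resp : ∀ s {f g} → R[t]._≋_ s f g → IsUnit (polyRing (R s)) g → IsUnit (polyRing (R s)) f
    unit-resp s {f} e (h , u) = h , CommutativeRing.trans (polyRing (R s)) (R[t].mul-congˡ s h e) u

  -- The remainder of Q modulo P is computed over the ultraproduct; it vanishes if it
  -- vanishes at almost all components.

  component-∤ : ∀ {d P Q} → Evaluation.IsMonic ultraproductRing d P → ¬ (∃[ c ] mul c P ≋ Q) →
                (λ s → ¬ (∃[ c ] R[t]._≋_ s (R[t].mul s c (component P s)) (component Q s))) ∈ 𝒟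
  component-∤ {d} {P} {Q} monic P∤Q = complement λ P∣Q →
    let (c , r , _ , l , Q≋cP+r) = Evaluation.divide ultraproductRing monic Q
        Qₛ≋ = upward (λ {s} e → ≡.subst (R[t]._≋_ s (component Q s))
                (≡.trans (component-add (mul c P) r s)
                  (≡.cong (λ p → R[t].add s p (component r s)) (component-mul c P s))) e)
              (component-≋ Q (add (mul c P) r) Q≋cP+r)
        r≋0 = component-≋⁻ r [] (both (intersection P∣Q Qₛ≋) (component-monic monic)
          λ {s} ((c′ , e) , e′) M → remainder-zero s M (component c s) c′ (component r s)
            (ℕ.≤-trans (ℕ.≤-reflexive (length-map _ r)) l) e e′)
    in P∤Q (c , ≋-sym (≋-trans Q≋cP+r (≋-trans (add-cong (≋-refl {mul c P}) r≋0) (+-identityʳ (mul c P)))))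
    where
    open CommutativeRing (polyRing ultraproductRing) using (+-identityʳ)
      renaming (refl to ≋-refl; sym to ≋-sym; trans to ≋-trans)
    remainder-zero : ∀ s {P Q} → Evaluation.IsMonic (R s) d P → ∀ c c′ r → length r ≤ d →
      R[t]._≋_ s (R[t].mul s c′ P) Q → R[t]._≋_ s Q (R[t].add s (R[t].mul s c P) r) → R[t]._≋_ s r []
    remainder-zero s {P} {Q} M c c′ r l e e′ = Evaluation.short-multiple (R s) M (c′ T.- c) r l (begin
      (c′ T.- c) T.* P                       ≈⟨ T.distribʳ P c′ (T.- c) ⟩
      c′ T.* P T.+ (T.- c) T.* P             ≈⟨ T.+-cong e (T.sym (-‿distribˡ-* c P)) ⟩
      Q T.- c T.* P                          ≈⟨ T.+-congʳ e′ ⟩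
      c T.* P T.+ r T.- c T.* P              ≈⟨ T.+-congʳ (T.+-comm (c T.* P) r) ⟩
      r T.+ c T.* P T.- c T.* P              ≈⟨ T.+-assoc r (c T.* P) _ ⟩
      r T.+ (c T.* P T.- c T.* P)            ≈⟨ T.+-congˡ {r} (T.-‿inverseʳ (c T.* P)) ⟩
      r T.+ T.0#                             ≈⟨ T.+-identityʳ r ⟩
      r                                      ∎)
      where
      module T = CommutativeRing (polyRing (R s))
      open RingProperties T.ring using (-‿distribˡ-*)
      open SetoidReasoning T.setoid

-- Transfer to the ultraproduct

module MonicForm (R : Ring) where
  open CommutativeRing R hiding (zero)
  open PolynomialRing R
  open Evaluation R

  -- The list of d + 1 coefficients that agrees with p below degree d and ends in 1.

  monicForm : ℕ → List Carrier → List Carrier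
  monicForm zero    p = 1# ∷ []
  monicForm (suc d) p = coeff p 0 ∷ monicForm d (drop 1 p)

  monicForm-monic : ∀ d p → IsMonic d (monicForm d p)
  monicForm-monic zero    p = leading refl
  monicForm-monic (suc d) p = coeff p 0 ∷ monicForm-monic d (drop 1 p)

  ≋-monicForm : ∀ d p → coeff p d ≈ 1# → (∀ i → d < i → coeff p i ≈ 0#) → p ≋ monicForm d p
  ≋-monicForm zero    p e f = coeffwise λ { zero → e ; (suc i) → f (suc i) (s≤s z≤n) }
  ≋-monicForm (suc d) p e f = coeffwise λ { zero → refl ; (suc i) → trans (sym (coeff-drop p i))
      (at (≋-monicForm d (drop 1 p) (trans (coeff-drop p d) e)
        (λ i l → trans (coeff-drop p i) (f (suc i) (s≤s l)))) i) }
    where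
    coeff-drop : ∀ p i → coeff (drop 1 p) i ≈ coeff p (suc i)
    coeff-drop []      i = refl
    coeff-drop (a ∷ p) i = refl

  degree-unique : ∀ p d d′ → Polynomials.HasDegree rawRing p d → Polynomials.HasDegree rawRing p d′ → d ≡ d′
  degree-unique p d d′ (pd≉0 , above) (pd′≉0 , above′) with ℕ.<-cmp d d′
  ... | tri< d<d′ _ _ = contradiction (above d′ d<d′) pd′≉0
  ... | tri≈ _ d≡d′ _ = d≡d′
  ... | tri> _ _ d′<d = contradiction (above′ d d′<d) pd≉0

IsResidueOf-cong : ∀ k {P P′ E α α′ x} → PolynomialRing._≋_ k P P′ → PolynomialRing._≋_ k α α′ →
                   IsResidueOf k P E α x → IsResidueOf k P′ E α′ x
IsResidueOf-cong k {P} {P′} {E} {α} {α′} {x} P≋P′ α≋α′ (unit , c , e) = unit , c ,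
  trans (*-congˡ {c} (sym P≋P′)) (trans e
    (+-congʳ {map (CommutativeRing.-_ k) (x ∷ [])} (Exp.^-congˡ commutativeSemiring E α≋α′)))
  where open CommutativeRing (polyRing k)

finiteField-isField : ∀ {k q} → IsFiniteField k q → IsField k
finiteField-isField finite = record { 1≉0 = 1≉0 ; inverse = inverse }
  where open IsFiniteField finite

finiteField-enumeration : ∀ {k q} → IsFiniteField k q → Enumeration k q
finiteField-enumeration {k} finite = record
  { element       = to
  ; index         = λ x → proj₁ (surjective x)
  ; element-index = λ x → proj₂ (surjective x) ≡.refl
  ; injective     = λ i j → injective
  }
  where open Bijection (IsFiniteField.bijection finite)

module _ (k : Ring) where
  open CommutativeRing k using (Carrier; _≈_; _*_; -_; 1#)
  open Exp (CommutativeRing.commutativeSemiring k) using (_^_)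

  -- x and y are the residues of Q modulo P and of P modulo Q, and satisfy reciprocity.

  ReciprocalResidues : (q : ℕ) (n : ℕ⁺) (d ℓ : ℕ) (P Q : List Carrier) → Carrier → Carrier → Set
  ReciprocalResidues q n d ℓ P Q x y =
    IsResidueOf k P (residueExponent q n d) Q x ×
    IsResidueOf k Q (residueExponent q n ℓ) P y ×
    x ≈ (- 1#) ^ signExponent q n d ℓ * y

module _ (lem : ExcludedMiddle) {k : Ring} where
  open CommutativeRing k using (_≈_; _*_; -_; 1#)
  open Exp (CommutativeRing.commutativeSemiring k) using (_^_)
  open PolynomialRing k using (_≋_; mul)

  component-reciprocity : ∀ {q} → IsFiniteField k q → ∀ n c → c ℤ.* + ℕ⁺.value n ≡ + q ℤ.- + 1 →
    ∀ {d-1 ℓ-1 P Q} →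
    Evaluation.IsMonic k (suc d-1) P → SplitsTrivially k P →
    Evaluation.IsMonic k (suc ℓ-1) Q → SplitsTrivially k Q →
    ¬ (∃[ c ] mul c P ≋ Q) → ¬ (∃[ c ] mul c Q ≋ P) →
    ∃₂ (ReciprocalResidues k q n (suc d-1) (suc ℓ-1) P Q)
  component-reciprocity finite n c cn≡q-1 {d-1} {ℓ-1} {P} {Q} monicP splitsP monicQ splitsQ P∤Q Q∤P =
    let (r , q≡) = Fermat.enumeration-size lem isField (finiteField-enumeration finite) in
    go r q≡ (finiteField-enumeration finite) cn≡q-1
    where
    isField = finiteField-isField finite
    d = suc d-1
    ℓ = suc ℓ-1
    e = ∣ c ∣
    go : ∀ {q} r → q ≡ suc (suc r) → Enumeration k q → c ℤ.* + ℕ⁺.value n ≡ + q ℤ.- + 1 →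
         ∃₂ (ReciprocalResidues k q n d ℓ P Q)
    go r ≡.refl enumeration cn≡1+r =
      let (x , y , x-residue , y-residue , x≈±y) =
            FiniteReciprocity.finite-reciprocity lem isField enumeration monicP splitsP monicQ splitsQ P∤Q Q∤P e
      in x , y ,
         ≡.subst (λ E → IsResidueOf k P E Q x) (≡.sym (Exponents.residueExponent-geometric r n e 1+r≡en d)) x-residue ,
         ≡.subst (λ E → IsResidueOf k Q E P y) (≡.sym (Exponents.residueExponent-geometric r n e 1+r≡en ℓ)) y-residue ,
         ≡.subst (λ E → x ≈ (- 1#) ^ E * y) (≡.sym (Exponents.signExponent-product r n e 1+r≡en d ℓ)) x≈±y
      where
      1+r≡en : suc r ≡ e ℕ.* ℕ⁺.value n
      1+r≡en = ≡.trans (≡.sym (≡.cong ∣_∣ cn≡1+r)) (ℤ.abs-* c (+ ℕ⁺.value n))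

module Transfer {S : Set} {𝒟 : Pred (Pred S 0ℓ) 0ℓ} (U : IsNonprincipalUltrafilter 𝒟)
                (field# : UltraFiniteField 𝒟) where
  open IsNonprincipalUltrafilter U
  open Ultrafilter U
  open ℕ⁺ using (value; nonZero)
  open UltraFiniteField field# using (q; 𝔽; almostFinite)
  open PowerResidue 𝒟 field#
  open Ultraproduct U 𝔽 using (component; component-≋; component-monic; component-splits; component-∤)
    renaming (ultraproductRing to F-ring)

  open PolynomialRing F-ring using (_≋_; coeffwise; at)
  open MonicForm F-ring

  private
    module 𝔽 (s : S) = CommutativeRing (𝔽 s)
    module 𝔽[t] (s : S) = CommutativeRing (polyRing (𝔽 s))
    module R[t] = CommutativeRing (polyRing F-ring)

  -- κ ^ d is represented by the powers q s ^ d.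

  κ^ : ∀ d s → (κ ℤ#.^ d) s ≡ + (value (q s) ℕ.^ d)
  κ^ zero    s = ≡.refl
  κ^ (suc d) s = ≡.trans (≡.cong (+ value (q s) ℤ.*_) (κ^ d s)) (≡.sym (ℤ.pos-* (value (q s)) (value (q s) ℕ.^ d)))

  -- The component at s of the exponent (κ ^ d - 1) / n.

  exponent : Hypernatural → ℕ → S → ℕ
  exponent n d s = ∣ ((κ ℤ#.^ d ℤ#.- ℤ#.1#) ÷ n) s ∣

  exponent-residueExponent : ∀ n d s → exponent n d s ≡ residueExponent (value (q s)) (n s) d
  exponent-residueExponent n d s = ≡.cong (λ i → ∣ _/ℕ_ (i ℤ.- + 1) (value (n s)) {{nonZero (n s)}} ∣) (κ^ d s)

  raw-power : ∀ s f E →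
    RawSemiringDefs._^_ (RawRing.rawSemiring (Polynomials.polynomialRing (componentRing s))) f E
    ≡ Exp._^_ (𝔽[t].commutativeSemiring s) f E
  raw-power s f zero    = ≡.refl
  raw-power s f (suc E) = ≡.cong (𝔽[t]._*_ s f) (raw-power s f E)

  -- x is the residue of α modulo P at almost all components, which is equivalent to
  -- IsResidue n P d α x (isResidue⁻, isResidue⁺).

  AlmostResidue : Hypernatural → (P : F[t].Carrier) (d : ℕ) (α : F[t].Carrier) → F.Carrier → Set
  AlmostResidue n P d α x = (λ s → IsResidueOf (𝔽 s) (component P s) (exponent n d s) (component α s) (x s)) ∈ 𝒟

  isResidue⁻ : ∀ {n P d α x} → IsResidue n P d α x → AlmostResidue n P d α x
  isResidue⁻ {n} {P} {d} {α} {x}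
    (record { quotient = u ; equality = ux≈1 } , record { quotient = c ; equality = cP≈ }) =
    both ux≈1 cP≈ λ {s} e f → (u s , e) , c s , PolynomialRing.coeffwise
      (≡.subst (λ p → ∀ i → 𝔽._≈_ s (PolynomialRing.coeff (𝔽 s) (𝔽[t]._*_ s (c s) (component P s)) i)
                              (PolynomialRing.coeff (𝔽 s) (𝔽[t]._-_ s p (x s ∷ [])) i))
        (raw-power s (component α s) (exponent n d s)) f)

  isResidue⁺ : ∀ {n P d α x} → AlmostResidue n P d α x → IsResidue n P d α x
  isResidue⁺ {n} {P} {d} {α} {x} residue =
    let (u , ux≈1) = choose (λ s → 𝔽.0# s) (upward (λ (unit , _) → unit) residue)
        (c , cP≈)  = choose (λ s → []) (upward (λ (_ , multiple) → multiple) residue)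
    in record { quotient = u ; equality = ux≈1 } , record { quotient = c ; equality = upward
      (λ {s} f → ≡.subst (λ p → ∀ i → 𝔽._≈_ s (PolynomialRing.coeff (𝔽 s) (𝔽[t]._*_ s (c s) (component P s)) i)
                                       (PolynomialRing.coeff (𝔽 s) (𝔽[t]._-_ s p (x s ∷ [])) i))
        (≡.sym (raw-power s (component α s) (exponent n d s))) (PolynomialRing.at f)) cP≈ }

  ∣⇒∃ : ∀ {P α} → P F[t].∣ α → ∃[ c ] c R[t].* P R[t].≈ α
  ∣⇒∃ record { quotient = c ; equality = e } = c , coeffwise e

  ∃⇒∣ : ∀ {P α} → ∃[ c ] c R[t].* P R[t].≈ α → P F[t].∣ α
  ∃⇒∣ (c , e) = record { quotient = c ; equality = at e }

  -- An irreducible divisor of an irreducible polynomial is associated to it.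

  ∣-antisym : ∀ {P Q} → F[t].Irreducible P → F[t].Irreducible Q → P F[t].∣ Q → Q F[t].∣ P
  ∣-antisym {P} {Q} P-irr Q-irr P∣Q = let (c , cP≈Q) = ∣⇒∃ P∣Q in
    byUnit c cP≈Q (RawSemiringDefs.Irreducible.split-∣1 Q-irr (at (R[t].sym cP≈Q)))
    where
    byUnit : ∀ c → c R[t].* P R[t].≈ Q → c F[t].∣ F[t].1# ⊎ P F[t].∣ F[t].1# → Q F[t].∣ P
    byUnit c cP≈Q (inj₂ P∣1) = contradiction P∣1 (RawSemiringDefs.Irreducible.p∤1 P-irr)
    byUnit c cP≈Q (inj₁ c∣1) = let (h , hc≈1) = ∣⇒∃ c∣1 in ∃⇒∣ (h , (begin
      h R[t].* Q              ≈⟨ R[t].*-congˡ {h} cP≈Q ⟨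
      h R[t].* (c R[t].* P)   ≈⟨ R[t].*-assoc h c P ⟨
      h R[t].* c R[t].* P     ≈⟨ R[t].*-congʳ {P} hc≈1 ⟩
      R[t].1# R[t].* P        ≈⟨ R[t].*-identityˡ P ⟩
      P                       ∎))
      where open SetoidReasoning R[t].setoid

  -- An irreducible monic polynomial has positive degree d, equals a list P₀ of exactly
  -- d + 1 coefficients ending in 1, and is irreducible at almost all components.

  record NormalForm (P : F[t].Carrier) (d : ℕ) : Set where
    field
      d-1    : ℕ
      d≡     : d ≡ suc d-1
      P₀     : F[t].Carrier
      P≋P₀   : P ≋ P₀
      monic  : Evaluation.IsMonic F-ring (suc d-1) P₀
      splits : (λ s → SplitsTrivially (𝔽 s) (component P₀ s)) ∈ 𝒟

  normalForm : ∀ {P d} → F[t].Monic P → F[t].Irreducible P → F[t].HasDegree P d → NormalForm P d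
  normalForm {P} {d} (d′ , degree′ , leading≈1) irr degree = byDegree d ≡.refl
    where
    P₀ = monicForm d P
    P≋P₀ : P ≋ P₀
    P≋P₀ = ≋-monicForm d P
      (≡.subst (λ d → F[t].coeff P d F.≈ F.1#) (degree-unique P d′ d degree′ degree) leading≈1) (proj₂ degree)
    byDegree : ∀ m → d ≡ m → NormalForm P d
    -- In degree 0, P would be the unit 1.
    byDegree zero    d≡0 = contradiction
      (∃⇒∣ (F[t].1# , R[t].trans (R[t].*-identityˡ P) (≡.subst (λ d → P ≋ monicForm d P) d≡0 P≋P₀)))
      (RawSemiringDefs.Irreducible.p∤1 irr)
    byDegree (suc m) d≡ = record
      { d-1    = m
      ; d≡     = d≡
      ; P₀     = P₀
      ; P≋P₀   = P≋P₀
      ; monic  = ≡.subst (λ m → Evaluation.IsMonic F-ring m P₀) d≡ (monicForm-monic d P)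
      ; splits = component-splits {P₀} λ f g e →
          ⊎.map ∣⇒∃ ∣⇒∃ (RawSemiringDefs.Irreducible.split-∣1 irr (at (R[t].trans P≋P₀ e)))
      }

  symbol : ∀ {n P d α x} → F[t].HasDegree P d → NormalForm P d → P F[t].∤ α →
           AlmostResidue n P d α x → IsPowerResidueSymbol n P α x
  symbol {n} {P} {d} {α} {x} degree normalForm P∤α residue =
    (λ P∣α → contradiction P∣α P∤α) ,
    λ _ → d , degree , isResidue⁺ {n} {P} {d} {α} {x} residue , λ y y-residue →
      both (intersection (component-≋ P P₀ P≋P₀) (component-monic monic))
        (intersection (isResidue⁻ {n} {P} {d} {α} {y} y-residue) residue)
        λ {s} (P≋ , M) (r , r′) → MonicResidue.residue-unique (𝔽 s) M {exponent n d s} {component α s}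
          (IsResidueOf-cong (𝔽 s) {E = exponent n d s} {α = component α s} P≋ (𝔽[t].refl s) r)
          (IsResidueOf-cong (𝔽 s) {E = exponent n d s} {α = component α s} P≋ (𝔽[t].refl s) r′)
    where open NormalForm normalForm

  symbol-zero : ∀ {n P α} → P F[t].∣ α → IsPowerResidueSymbol n P α F.0#
  symbol-zero P∣α = (λ _ → always λ s → 𝔽.refl s) , λ P∤α → contradiction P∣α P∤α

  -- The conclusion of the theorem.

  Reciprocity : Hypernatural → (P Q : F[t].Carrier) (d ℓ : ℕ) → Set
  Reciprocity n P Q d ℓ = ∃₂ λ x y →
    IsPowerResidueSymbol n P Q x × IsPowerResidueSymbol n Q P y ×
    x F.≈ ((F.- F.1#) ^F (((κ ℤ#.- ℤ#.1#) ÷ n) ℤ#.* diagonal d ℤ#.* diagonal ℓ)) F.* y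

  reciprocity-divisible : ∀ {n P Q d ℓ} → P F[t].∣ Q → Q F[t].∣ P → Reciprocity n P Q d ℓ
  reciprocity-divisible {n} {P} {Q} P∣Q Q∣P = F.0# , F.0# ,
    symbol-zero {n} {P} {Q} P∣Q , symbol-zero {n} {Q} {P} Q∣P , always λ s → 𝔽.sym s (𝔽.zeroʳ s _)

  reciprocity-indivisible : ∀ {n P Q d ℓ} → fromHypernatural n ℤ#.∣ (κ ℤ#.- ℤ#.1#) →
    F[t].HasDegree P d → NormalForm P d → F[t].HasDegree Q ℓ → NormalForm Q ℓ →
    P F[t].∤ Q → Q F[t].∤ P → Reciprocity n P Q d ℓ
  reciprocity-indivisible {n} {P} {Q} {d} {ℓ} record { quotient = c ; equality = cn≈κ-1 }
    P-degree NP Q-degree NQ P∤Q Q∤P =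
    let (xy , residues) = choose {C = ResidueAt} (λ s → 𝔽.0# s , 𝔽.0# s)
          (both (intersection almostFinite cn≈κ-1)
            (intersection (intersection (component-monic NP.monic) (component-monic NQ.monic))
              (intersection (intersection NP.splits NQ.splits)
                (intersection (component-∤ NP.monic P₀∤Q₀) (component-∤ NQ.monic Q₀∤P₀))))
            λ {s} (finite , cn≡) ((MP , MQ) , (SP , SQ) , ∤Q , ∤P) →
              let (x , y , r) = component-reciprocity excludedMiddle finite (n s) (c s) cn≡ MP SP MQ SQ ∤Q ∤P
              in (x , y) , r)
        P≋ = component-≋ P NP.P₀ NP.P≋P₀
        Q≋ = component-≋ Q NQ.P₀ NQ.P≋P₀
        x s = proj₁ (xy s)
        y s = proj₂ (xy s)
    in x , y ,
       symbol {n} {P} {d} {Q} {x} P-degree NP P∤Q (both (intersection P≋ Q≋) residues λ {s} (p , q) (r , _ , _) →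
         transport NP.d≡ s p q r) ,
       symbol {n} {Q} {ℓ} {P} {y} Q-degree NQ Q∤P (both (intersection P≋ Q≋) residues λ {s} (p , q) (_ , r , _) →
         transport NQ.d≡ s q p r) ,
       upward (λ {s} (_ , _ , e) → ≡.subst₂
         (λ d ℓ → 𝔽._≈_ s (x s) (𝔽._*_ s (Exp._^_ (𝔽.commutativeSemiring s) (𝔽.-_ s (𝔽.1# s))
           (signExponent (value (q s)) (n s) d ℓ)) (y s)))
         (≡.sym NP.d≡) (≡.sym NQ.d≡) e) residues
    where
    module NP = NormalForm NP
    module NQ = NormalForm NQ
    ResidueAt : ∀ s → 𝔽.Carrier s × 𝔽.Carrier s → Set
    ResidueAt s (x , y) = ReciprocalResidues (𝔽 s) (value (q s)) (n s)
      (suc NP.d-1) (suc NQ.d-1) (component NP.P₀ s) (component NQ.P₀ s) x y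
    transport : ∀ {d d-1} → d ≡ suc d-1 → ∀ s {P P₀ α α₀ x} →
      PolynomialRing._≋_ (𝔽 s) P P₀ → PolynomialRing._≋_ (𝔽 s) α α₀ →
      IsResidueOf (𝔽 s) P₀ (residueExponent (value (q s)) (n s) (suc d-1)) α₀ x →
      IsResidueOf (𝔽 s) P (exponent n d s) α x
    transport {d} ≡.refl s {P} {P₀} {α} {α₀} {x} p a r = ≡.subst (λ E → IsResidueOf (𝔽 s) P E α x)
      (≡.sym (exponent-residueExponent n d s))
      (IsResidueOf-cong (𝔽 s) {E = residueExponent (value (q s)) (n s) d} (𝔽[t].sym s p) (𝔽[t].sym s a) r)
    nondivisor : ∀ {P P₀ Q Q₀} → P ≋ P₀ → Q ≋ Q₀ → P F[t].∤ Q → ¬ (∃[ c ] c R[t].* P₀ R[t].≈ Q₀)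
    nondivisor p q P∤Q (c , e) = P∤Q (∃⇒∣ (c , R[t].trans (R[t].*-congˡ {c} p) (R[t].trans e (R[t].sym q))))
    P₀∤Q₀ = nondivisor NP.P≋P₀ NQ.P≋P₀ P∤Q
    Q₀∤P₀ = nondivisor NQ.P≋P₀ NP.P≋P₀ Q∤P

theorem1p2 :
    {S : Set} → Infinite S →
    (𝒟 : Pred (Pred S 0ℓ) 0ℓ) → IsNonprincipalUltrafilter 𝒟 →
    (field# : UltraFiniteField 𝒟) →
    let open PowerResidue 𝒟 field#
        κ-1 = κ ℤ#.- ℤ#.1#
    in
    (n : Hypernatural) → fromHypernatural n ℤ#.∣ κ-1 →
    (P Q : F[t].Carrier) → F[t].Monic P → F[t].Monic Q →
    F[t].Irreducible P → F[t].Irreducible Q →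
    (d ℓ : ℕ) → F[t].HasDegree P d → F[t].HasDegree Q ℓ →
    ∃₂ λ x y →
      IsPowerResidueSymbol n P Q x ×
      IsPowerResidueSymbol n Q P y ×
      x F.≈ ((F.- F.1#) ^F ((κ-1 ÷ n) ℤ#.* diagonal d ℤ#.* diagonal ℓ)) F.* y
theorem1p2 _ 𝒟 U field# n n∣κ-1 P Q P-monic Q-monic P-irr Q-irr d ℓ P-degree Q-degree =
  byDivisibility (excludedMiddle (P F[t].∣ Q))
  where
  open Ultrafilter U using (excludedMiddle)
  open PowerResidue 𝒟 field#
  open Transfer U field#
  byDivisibility : Dec (P F[t].∣ Q) → Reciprocity n P Q d ℓ
  byDivisibility (yes P∣Q) = reciprocity-divisible {n} {P} {Q} {d} {ℓ} P∣Q (∣-antisym P-irr Q-irr P∣Q)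
  byDivisibility (no  P∤Q) = reciprocity-indivisible {n} {P} {Q} n∣κ-1
    P-degree (normalForm P-monic P-irr P-degree) Q-degree (normalForm Q-monic Q-irr Q-degree)
    P∤Q (λ Q∣P → P∤Q (∣-antisym Q-irr P-irr Q∣P))
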